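{- For the problem of scheduling with uncertain processing times on a single machine with the objective of minimizing the total completion time, the randomized algorithm $\beta$-RPCP with $\beta=2$ has expected competitive ratio at most $\frac{3(7+3\sqrt6)}{20}\le 2.152271$. Here, with $r_j=u_j/t_j$, job $j$ is tested with probability $\mathbb P_j=\frac{3r_j^2-3r_j}{3r_j^2-4r_j+3}$ for $1\le r_j\le 3$ (and with probability $0$ if $r_j<1$, probability $1$ if $r_j>3$).
   Context: Problem. There are $n$ jobs, all available at time $0$. Job $j$ has a testing time $t_j> 0$, an upper limit $u_j> 0$, and a real processing time $p_j\in[0,u_j]$. A job may be executed untested, which takes $u_j$ time units, or it may be tested (taking $t_j$ time units) and later executed in $p_j$ time units; other tasks may run between the test and the execution. A single machine runs one task at a time. The completion time of a job is the time at which its execution (or execution-untested) ends, and the cost of a schedule is the sum of the completion times of all jobs. An online algorithm knows all $t_j,u_j$ from the start, but learns $p_j$ only when the test of $j$ is finished. $\mathrm{OPT}$ knows all $p_j$ in advance (but must still test $j$ in order to run it in time $p_j$), and its cost is the minimum cost of any schedule. The expected competitive ratio of a randomized online algorithm $A$ is the smallest $c$ such that $\mathbb E[\mathrm{cost}(A)]\le c\cdot \mathrm{cost}(\mathrm{OPT})$ on all instances. Algorithm $\beta$-RPCP. Maintain a priority queue of tasks, smaller weight meaning higher priority (ties broken arbitrarily). Initially, for each job $j$, independently: with probability $\mathbb P_j$ insert a testing task of weight $\beta t_j$ (job $j$ is tested), and with probability $1-\mathbb P_j$ insert an execution-untested task of weight $u_j$ (job $j$ is not tested). While the queue is nonempty,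 extract a task of smallest weight and run it; if it was the testing task of job $j$, then after the test insert an execution task for $j$ with weight $t_j+p_j$ (running this execution task takes $p_j$ time). -}

module Defs where

open import Algebra.Bundles using (CommutativeRing)
open import Algebra.Structures using (IsCommutativeRing)
import Algebra.Properties.CommutativeMonoid.Sum as Sum
import Algebra.Properties.Semiring.Mult as Mult
open import Data.Bool.Base using (Bool; true; false; if_then_else_)
open import Data.Fin.Base using (Fin)
open import Data.Fin.Properties using (_≟_)
open import Data.List.Base using (List; []; _∷_; map; allFin)
open import Data.List.Membership.Propositional using (_∈_)
import Data.List.Extrema as Extrema
open import Data.List.Relation.Unary.All using (All; _∷_)
open import Data.List.Relation.Unary.Any using (_─_; here; there)
open import Data.Nat.Base as ℕ using (ℕ)
import Data.Nat.Properties as ℕₚ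
open import Data.Product.Base using (Σ-syntax; ∃; ∃-syntax; _×_; _,_; proj₁; proj₂)
open import Data.Sum.Base using (_⊎_; inj₁; inj₂)
open import Data.Unit.Base using (⊤; tt)
open import Data.Vec.Base using (Vec; []; _∷_; lookup; tabulate)
open import Data.Fin.Subset using (Subset)
open import Level using (Level; _⊔_; suc)
open import Relation.Binary.Bundles using (DecTotalOrder)
open import Relation.Binary.Core using (Rel)
open import Relation.Binary.Structures using (IsDecTotalOrder)
import Relation.Binary.Construct.NonStrictToStrict as Strict
open import Relation.Binary.PropositionalEquality.Core using (_≡_; refl; cong)
open import Relation.Nullary using (¬_; does; contradiction)

-- The real numbers enter only as an ordered field.  As usual for fields with
-- a total inverse, the value of  0# ⁻¹  is unconstrained.
record OrderedField (c ℓ₁ ℓ₂ : Level) : Set (suc (c ⊔ ℓ₁ ⊔ ℓ₂)) where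
  infix  8 -_
  infix  9 _⁻¹
  infixl 7 _*_ _/_
  infixl 6 _+_ _-_
  infix  4 _≈_ _≤_
  field
    Carrier           : Set c
    _≈_               : Rel Carrier ℓ₁
    _≤_               : Rel Carrier ℓ₂
    _+_ _*_           : Carrier → Carrier → Carrier
    -_ _⁻¹            : Carrier → Carrier
    0# 1#             : Carrier
    isCommutativeRing : IsCommutativeRing _≈_ _+_ _*_ -_ 0# 1#
    isDecTotalOrder   : IsDecTotalOrder _≈_ _≤_
    0≉1               : ¬ (0# ≈ 1#)
    ⁻¹-cong           : ∀ {x y} → x ≈ y → x ⁻¹ ≈ y ⁻¹
    ⁻¹-inverseʳ       : ∀ x → ¬ (x ≈ 0#) → x * x ⁻¹ ≈ 1#
    +-monoʳ-≤         : ∀ x {y z} → y ≤ z → x + y ≤ x + z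
    *-nonNeg          : ∀ {x y} → 0# ≤ x → 0# ≤ y → 0# ≤ x * y

  commutativeRing : CommutativeRing c ℓ₁
  commutativeRing = record { isCommutativeRing = isCommutativeRing }

  decTotalOrder : DecTotalOrder c ℓ₁ ℓ₂
  decTotalOrder = record { isDecTotalOrder = isDecTotalOrder }

  open CommutativeRing commutativeRing public
    using (semiring; +-commutativeMonoid)
    renaming (refl to ≈-refl)
  open DecTotalOrder decTotalOrder public
    using (_≤?_; totalOrder)
    renaming (refl to ≤-refl; trans to ≤-trans; total to ≤-total)
  open Strict _≈_ _≤_ public using (_<_)

  _-_ _/_ : Carrier → Carrier → Carrier
  x - y = x + (- y)
  x / y = x * y ⁻¹

  fromℕ : ℕ → Carrier
  fromℕ k = Mult._×_ semiring k 1#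

  record IsSqrt (x s : Carrier) : Set (ℓ₁ ⊔ ℓ₂) where
    field
      nonNeg : 0# ≤ s
      square : s * s ≈ x

data Task (n : ℕ) : Set where
  test     : Fin n → Task n
  execute  : Fin n → Task n
  untested : Fin n → Task n

-- Does the task complete the given job?
finishes : ∀ {n} → Task n → Fin n → Bool
finishes (test i)     j = false
finishes (execute i)  j = does (i ≟ j)
finishes (untested i) j = does (i ≟ j)

-- The tasks available at time 0 when exactly the jobs in T are to be tested.
initial : ∀ {n} → Subset n → List (Task n)
initial {n} T = map (λ j → if lookup T j then test j else untested j) (allFin n)

-- The tasks available after running a task, given the remaining ones: the test
-- of a job releases the execution of that job.
release : ∀ {n} → Task n → List (Task n) → List (Task n)
release (test j)     q = execute j ∷ q
release (execute j)  q = q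
release (untested j) q = q

-- Execution Pick q xs: the tasks xs can be run in this order, starting with
-- the available tasks q and leaving none, where a task x may be taken from the
-- available tasks q' only if  Pick x q'.
data Execution {n ℓ} (Pick : Task n → List (Task n) → Set ℓ) :
               List (Task n) → List (Task n) → Set ℓ where
  []   : Execution Pick [] []
  step : ∀ {q x xs} (x∈q : x ∈ q) → Pick x q →
         Execution Pick (release x (q ─ x∈q)) xs →
         Execution Pick q (x ∷ xs)

module Scheduling {c ℓ₁ ℓ₂} (K : OrderedField c ℓ₁ ℓ₂) where
  open OrderedField K
  open Sum +-commutativeMonoid using (sum)

  record Instance (n : ℕ) : Set (c ⊔ ℓ₁ ⊔ ℓ₂) where
    field
      t u p : Fin n → Carrier
      t>0   : ∀ j → 0# < t j
      u>0   : ∀ j → 0# < u j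
      p≥0   : ∀ j → 0# ≤ p j
      p≤u   : ∀ j → p j ≤ u j

  module _ {n} (I : Instance n) where
    open Instance I

    duration : Task n → Carrier
    duration (test j)     = t j
    duration (execute j)  = p j
    duration (untested j) = u j

    -- When job j completes if the tasks are run in the given order without
    -- idle time from time s on.  The value for [] is junk: an execution that
    -- starts from  initial T  completes every job exactly once.
    completionTime : Carrier → List (Task n) → Fin n → Carrier
    completionTime s []       j = 0#
    completionTime s (x ∷ xs) j =
      if finishes x j then s + duration x
                      else completionTime (s + duration x) xs j

    cost : List (Task n) → Carrier
    cost xs = sum (completionTime 0# xs)

    -- A schedule tests an arbitrary set of jobs and runs the available tasks
    -- in an arbitrary order.
    record Schedule : Set where
      field
        tested    : Subset n
        order     : List (Task n)
        execution : Execution (λ _ _ → ⊤) (initial tested) order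

    scheduleCost : Schedule → Carrier
    scheduleCost S = cost (Schedule.order S)

    record IsOPT (v : Carrier) : Set (ℓ₁ ⊔ ℓ₂) where
      field
        schedule : Schedule
        attained : scheduleCost schedule ≈ v
        minimal  : ∀ S → v ≤ scheduleCost S

    module RPCP (β : Carrier) where

      weight : Task n → Carrier
      weight (test j)     = β * t j
      weight (execute j)  = t j + p j
      weight (untested j) = u j

      Smallest : Task n → List (Task n) → Set ℓ₂
      Smallest x q = All (λ y → weight x ≤ weight y) q

  -- The run of β-RPCP for each outcome T of the random choice of the jobs to
  -- be tested, for some way of breaking ties.
  record RPCPRuns {n} (I : Instance n) (β : Carrier) : Set ℓ₂ where
    open RPCP I β
    field
      order     : Subset n → List (Task n)
      execution : ∀ T → Execution Smallest (initial T) (order T)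

  -- Expectation of f T when T contains each j independently with
  -- probability  lookup P j.
  𝔼 : ∀ {n} → Vec Carrier n → (Subset n → Carrier) → Carrier
  𝔼 []       f = f []
  𝔼 (π ∷ P) f = π * 𝔼 P (λ T → f (true ∷ T)) + (1# - π) * 𝔼 P (λ T → f (false ∷ T))

  -- The algorithm is given by β and the probability of testing a job as a
  -- function of u / t.
  RPCP-CompetitiveRatioAtMost : Carrier → (Carrier → Carrier) → Carrier → Set (c ⊔ ℓ₁ ⊔ ℓ₂)
  RPCP-CompetitiveRatioAtMost β prob ρ =
    ∀ {n} (I : Instance n) (runs : RPCPRuns I β) opt → IsOPT I opt →
    let open Instance I
        P = tabulate (λ j → prob (u j / t j))
    in 𝔼 P (λ T → cost I (RPCPRuns.order runs T)) ≤ ρ * opt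

  testProbability : Carrier → Carrier
  testProbability r =
    if does (1# ≤? r)
    then (if does (r ≤? fromℕ 3)
          then (fromℕ 3 * (r * r) - fromℕ 3 * r) /
               (fromℕ 3 * (r * r) - fromℕ 4 * r + fromℕ 3)
          else 1#)
    else 0#

-- Every instance has an OPT value and a run of β-RPCP, so the quantification
-- over them in RPCP-CompetitiveRatioAtMost is never vacuous.
module Existence {c ℓ₁ ℓ₂} (K : OrderedField c ℓ₁ ℓ₂) where
  open OrderedField K
  open Scheduling K
  open Extrema totalOrder using (argmin; argmin-sel; f[argmin]≤f[⊤]; f[argmin]≤f[xs])

  private
    size : ∀ {n} → Task n → ℕ
    size (test j)     = 2
    size (execute j)  = 1
    size (untested j) = 1

    queueSize : ∀ {n} → List (Task n) → ℕ
    queueSize []      = 0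
    queueSize (x ∷ q) = size x ℕ.+ queueSize q

    release-add : ∀ {n} (x : Task n) q → queueSize (release x q) ℕ.< size x ℕ.+ queueSize q
    release-add (test j)     q = ℕₚ.≤-refl
    release-add (execute j)  q = ℕₚ.≤-refl
    release-add (untested j) q = ℕₚ.≤-refl

    remove : ∀ {n} {x : Task n} {q} (x∈q : x ∈ q) →
             size x ℕ.+ queueSize (q ─ x∈q) ℕ.≤ queueSize q
    remove (here refl) = ℕₚ.≤-refl
    remove {x = x} {y ∷ q} (there x∈q) = begin
      size x ℕ.+ (size y ℕ.+ queueSize (q ─ x∈q))  ≡⟨ ℕₚ.+-assoc (size x) _ _ ⟨
      size x ℕ.+ size y ℕ.+ queueSize (q ─ x∈q)    ≡⟨ cong (ℕ._+ queueSize (q ─ x∈q)) (ℕₚ.+-comm (size x) (size y)) ⟩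
      size y ℕ.+ size x ℕ.+ queueSize (q ─ x∈q)    ≡⟨ ℕₚ.+-assoc (size y) _ _ ⟩
      size y ℕ.+ (size x ℕ.+ queueSize (q ─ x∈q))  ≤⟨ ℕₚ.+-monoʳ-≤ (size y) (remove x∈q) ⟩
      size y ℕ.+ queueSize q                        ∎
      where open ℕₚ.≤-Reasoning

    shrink : ∀ {n m} {x : Task n} {q} (x∈q : x ∈ q) → queueSize q ℕ.≤ ℕ.suc m →
             queueSize (release x (q ─ x∈q)) ℕ.≤ m
    shrink {x = x} {q} x∈q q≤ = ℕₚ.≤-pred
      (ℕₚ.≤-trans (release-add x (q ─ x∈q)) (ℕₚ.≤-trans (remove x∈q) q≤))

    nonempty : ∀ {n} {x : Task n} {q} → ¬ (queueSize (x ∷ q) ℕ.≤ 0)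
    nonempty {x = test j}     ()
    nonempty {x = execute j}  ()
    nonempty {x = untested j} ()

    bestMember : ∀ {n} (x : Task n) q (g : ∀ {y} → y ∈ x ∷ q → Carrier) →
                 ∃ λ y → Σ[ y∈ ∈ y ∈ x ∷ q ] (∀ {z} (z∈ : z ∈ x ∷ q) → g y∈ ≤ g z∈)
    bestMember x [] g = x , here refl , λ { (here refl) → ≤-refl }
    bestMember x (x′ ∷ q) g with bestMember x′ q (λ y∈ → g (there y∈))
    ... | y , y∈ , y-min with ≤-total (g (here refl)) (g (there y∈))
    ... | inj₁ x≤y = x , here refl ,
      λ { (here refl) → ≤-refl ; (there z∈) → ≤-trans x≤y (y-min z∈) }
    ... | inj₂ y≤x = y , there y∈ ,
      λ { (here refl) → y≤x ; (there z∈) → y-min z∈ }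

    Any : ∀ {n} → Task n → List (Task n) → Set
    Any _ _ = ⊤

    bestOrder : ∀ {n} m (q : List (Task n)) → queueSize q ℕ.≤ m → (f : List (Task n) → Carrier) →
                ∃[ xs ] Execution Any q xs × (∀ {ys} → Execution Any q ys → f xs ≤ f ys)
    bestOrder m         []      _  f = [] , [] , λ { [] → ≤-refl ; (step () _ _) }
    bestOrder ℕ.zero    (x ∷ q) q≤ f = contradiction q≤ (nonempty {x = x} {q})
    bestOrder (ℕ.suc m) (x ∷ q) q≤ f =
      let y , y∈ , y-min = bestMember x q (λ {z} z∈ → f (z ∷ proj₁ (rest z∈)))
          xs , e , _ = rest y∈
      in y ∷ xs , step y∈ tt e ,
         λ { (step z∈ _ e′) → ≤-trans (y-min z∈) (proj₂ (proj₂ (rest z∈)) e′) }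
      where
      rest = λ {z} (z∈ : z ∈ x ∷ q) →
        bestOrder m (release z ((x ∷ q) ─ z∈)) (shrink z∈ q≤) (λ zs → f (z ∷ zs))

    bestSubset : ∀ n (g : Subset n → Carrier) → ∃[ T ] (∀ T′ → g T ≤ g T′)
    bestSubset ℕ.zero    g = [] , λ { [] → ≤-refl }
    bestSubset (ℕ.suc n) g
      with bestSubset n (λ T → g (true ∷ T)) | bestSubset n (λ T → g (false ∷ T))
    ... | T₁ , min₁ | T₀ , min₀ with ≤-total (g (true ∷ T₁)) (g (false ∷ T₀))
    ... | inj₁ le = true ∷ T₁ ,
      λ { (true ∷ T) → min₁ T ; (false ∷ T) → ≤-trans le (min₀ T) }
    ... | inj₂ le = false ∷ T₀ ,
      λ { (true ∷ T) → ≤-trans le (min₁ T) ; (false ∷ T) → min₀ T }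

  OPT-exists : ∀ {n} (I : Instance n) → ∃[ v ] IsOPT I v
  OPT-exists {n} I =
    let T , T-min   = bestSubset n (λ T → cost I (proj₁ (best T)))
        xs , e , _  = best T
    in cost I xs , record
      { schedule = record { tested = T ; order = xs ; execution = e }
      ; attained = ≈-refl
      ; minimal  = λ S → ≤-trans (T-min (Schedule.tested S))
                                 (proj₂ (proj₂ (best (Schedule.tested S))) (Schedule.execution S))
      }
    where best = λ (T : Subset n) → bestOrder _ (initial T) ℕₚ.≤-refl (cost I)

  runs-exist : ∀ {n} (I : Instance n) β → RPCPRuns I β
  runs-exist I β = record
    { order     = λ T → proj₁ (run _ (initial T) ℕₚ.≤-refl)
    ; execution = λ T → proj₂ (run _ (initial T) ℕₚ.≤-refl)
    }
    where
    open RPCP I β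
    run : ∀ m q → queueSize q ℕ.≤ m → ∃[ xs ] Execution Smallest q xs
    run m         []      _  = [] , []
    run ℕ.zero    (x ∷ q) q≤ = contradiction q≤ (nonempty {x = x} {q})
    run (ℕ.suc m) (x ∷ q) q≤ =
      let y∈ = member (argmin-sel weight x q)
          xs , e = run m _ (shrink y∈ q≤)
      in argmin weight x q ∷ xs ,
         step y∈ (f[argmin]≤f[⊤] {f = weight} x q ∷ f[argmin]≤f[xs] {f = weight} x q) e
      where
      member : argmin weight x q ≡ x ⊎ argmin weight x q ∈ q → argmin weight x q ∈ x ∷ q
      member (inj₁ eq) = here eq
      member (inj₂ y∈) = there y∈

{-# OPTIONS --safe #-}

-- The cost of a schedule is the sum over all pairs (i , j) of the time spent
-- on i until j completes, so it is enough to compare algorithm and optimum for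
-- each unordered pair, i.e. the total time d spent on i and j until the first
-- of them completes.  In the optimum d is at least the full time of one of the
-- two jobs, whichever completes first.  In a run of 2-RPCP, with a = t + p,
-- either job satisfies d ≤ max(3a/2, t + a) if it is tested and d ≤ 3u/2 if it
-- is not, whatever happens to the other job.  So the expectation of d involves
-- the random choice for a single job, and it is at most ρ min(a, u): after
-- division by t the critical cases p = 0 and p = u both ask for
-- 9r² − 3r ≤ 2ρ(3r² − 4r + 3), where the discriminant of the difference of the
-- two sides vanishes for the given ρ.

module Submission where

open import Defs
open import Algebra.Bundles using (CommutativeRing)
import Algebra.Properties.CommutativeMonoid.Sum as Sum
import Algebra.Properties.Semiring.Mult as Mult
import Algebra.Solver.Ring.NaturalCoefficients.Default as NaturalCoefficients
open import Data.Bool.Base using (Bool; true; false; if_then_else_)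
open import Data.Fin.Base using (Fin; zero; suc)
open import Data.Fin.Properties using (_≟_; suc-injective)
open import Data.Fin.Subset using (Subset)
open import Data.List.Base as List using (List; []; _∷_; map)
open import Data.List.Membership.Propositional using (_∈_)
open import Data.List.Relation.Unary.All as All using (All; []; _∷_)
open import Data.List.Relation.Unary.All.Properties using (─⁺)
open import Data.List.Relation.Unary.Any using (_─_; here; there)
open import Data.Nat.Base as ℕ using (ℕ)
import Data.Nat.Properties as ℕₚ
open import Data.Product.Base using (∃-syntax; _×_; _,_; proj₁; proj₂)
open import Data.Sum.Base using (_⊎_; inj₁; inj₂)
open import Data.Unit.Base using (tt)
open import Data.Vec.Base using (Vec; []; _∷_; lookup; tabulate)
open import Data.Vec.Properties using (lookup∘tabulate)
open import Function.Base using (_∘_; case_of_)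
open import Level using (Level; _⊔_)
open import Relation.Binary.Bundles using (DecTotalOrder)
open import Relation.Binary.PropositionalEquality.Core as ≡ using (_≡_; _≢_)
import Relation.Binary.Reasoning.PartialOrder as PartialOrderReasoning
open import Relation.Nullary using (¬_; does; yes; no; contradiction)
open import Relation.Nullary.Decidable using (dec-true; dec-false)

-- Arithmetic in ordered fields.

module OrderedFieldProperties {c ℓ₁ ℓ₂} (K : OrderedField c ℓ₁ ℓ₂) where
  open OrderedField K
  open CommutativeRing commutativeRing public
    using ( refl; reflexive; sym; trans; +-cong; +-congˡ; +-congʳ; *-cong; *-congˡ; *-congʳ; +-assoc; +-comm
          ; +-identityˡ; +-identityʳ; -‿inverseʳ; -‿inverseˡ; *-assoc; *-comm; *-identityˡ; *-identityʳ
          ; zeroʳ; distribˡ; distribʳ; commutativeSemiring)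
  open DecTotalOrder decTotalOrder public
    using (poset) renaming (antisym to ≤-antisym; reflexive to ≤-reflexive)
  module ≤-Reasoning = PartialOrderReasoning poset
  open NaturalCoefficients commutativeSemiring public
    using (Polynomial; con; solve; _:=_; _:+_; _:*_)

  -- Unary, so that it evaluates definitionally to fromℕ n.
  num : ∀ {k} → ℕ → Polynomial k
  num ℕ.zero    = con 0
  num (ℕ.suc n) = con 1 :+ num n

  +-monoˡ-≤ : ∀ z {x y} → x ≤ y → x + z ≤ y + z
  +-monoˡ-≤ z {x} {y} x≤y = begin
    x + z  ≈⟨ +-comm x z ⟩
    z + x  ≤⟨ +-monoʳ-≤ z x≤y ⟩
    z + y  ≈⟨ +-comm z y ⟩
    y + z  ∎
    where open ≤-Reasoning

  infixl 6 _⊕_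

  _⊕_ : ∀ {x y z w} → x ≤ y → z ≤ w → x + z ≤ y + w
  x≤y ⊕ z≤w = ≤-trans (+-monoˡ-≤ _ x≤y) (+-monoʳ-≤ _ z≤w)

  +-cancelʳ-≤ : ∀ z {x y} → x + z ≤ y + z → x ≤ y
  +-cancelʳ-≤ z {x} {y} le = begin
    x                ≈⟨ cancel x ⟨
    x + z + (- z)    ≤⟨ +-monoˡ-≤ (- z) le ⟩
    y + z + (- z)    ≈⟨ cancel y ⟩
    y                ∎
    where
    open ≤-Reasoning
    cancel : ∀ w → w + z + (- z) ≈ w
    cancel w = trans (+-assoc w z (- z)) (trans (+-congˡ (-‿inverseʳ z)) (+-identityʳ w))

  -- A Farkas certificate: x ≤ y follows from l ≤ r once a semiring identity
  -- expresses y − x as r − l.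
  certify : ∀ {x y l r} → l ≤ r → x + r ≈ y + l → x ≤ y
  certify {x} {y} {l} {r} l≤r eq =
    +-cancelʳ-≤ l (≤-trans (+-monoʳ-≤ x l≤r) (≤-reflexive eq))

  ≤⇒difference : ∀ {x y} → x ≤ y → ∃[ d ] 0# ≤ d × y ≈ x + d
  ≤⇒difference {x} {y} x≤y = - x + y , ≤-trans (≤-reflexive (sym (-‿inverseˡ x))) (+-monoʳ-≤ (- x) x≤y) ,
    sym (trans (sym (+-assoc x (- x) y)) (trans (+-congʳ (-‿inverseʳ x)) (+-identityˡ y)))

  *-monoˡ-≤ : ∀ {z x y} → 0# ≤ z → x ≤ y → z * x ≤ z * y
  *-monoˡ-≤ {z} {x} {y} 0≤z x≤y with ≤⇒difference x≤y
  ... | d , 0≤d , y≈x+d = begin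
    z * x           ≈⟨ +-identityʳ _ ⟨
    z * x + 0#      ≤⟨ +-monoʳ-≤ _ (*-nonNeg 0≤z 0≤d) ⟩
    z * x + z * d   ≈⟨ distribˡ z x d ⟨
    z * (x + d)     ≈⟨ *-congˡ y≈x+d ⟨
    z * y           ∎
    where open ≤-Reasoning

  *-monoʳ-≤ : ∀ {z x y} → 0# ≤ z → x ≤ y → x * z ≤ y * z
  *-monoʳ-≤ {z} {x} {y} 0≤z x≤y = begin
    x * z  ≈⟨ *-comm x z ⟩
    z * x  ≤⟨ *-monoˡ-≤ 0≤z x≤y ⟩
    z * y  ≈⟨ *-comm z y ⟩
    y * z  ∎
    where open ≤-Reasoning

  *-cancelˡ-≤ : ∀ {z x y} → 0# ≤ z → ¬ (z ≈ 0#) → z * x ≤ z * y → x ≤ y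
  *-cancelˡ-≤ {z} {x} {y} 0≤z z≉0 le with ≤-total x y
  ... | inj₁ x≤y = x≤y
  ... | inj₂ y≤x = ≤-reflexive (trans (sym (unscale x))
          (trans (*-congʳ (≤-antisym le (*-monoˡ-≤ 0≤z y≤x))) (unscale y)))
    where
    unscale : ∀ w → z * w * z ⁻¹ ≈ w
    unscale w = trans (solve 3 (λ z w i → z :* w :* i := z :* i :* w) refl z w (z ⁻¹))
                      (trans (*-congʳ (⁻¹-inverseʳ z z≉0)) (*-identityˡ w))

  /-*-cancel : ∀ x {y} → ¬ (y ≈ 0#) → x / y * y ≈ x
  /-*-cancel x {y} y≉0 = trans (solve 3 (λ x y i → x :* i :* y := x :* (y :* i)) refl x y (y ⁻¹))
                        (trans (*-congˡ (⁻¹-inverseʳ y y≉0)) (*-identityʳ x))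

  -- Writing the larger argument as the smaller one plus `d` turns the difference of the sides into
  -- d², with no subtraction for the semiring solver to handle. Applied to suitable arguments, this
  -- is how squares enter the certificates below.
  2xy≤x²+y² : ∀ x y → x * y + x * y ≤ x * x + y * y
  2xy≤x²+y² x y with ≤-total x y
  ... | inj₁ x≤y = ordered x≤y
    where
    ordered : ∀ {x y} → x ≤ y → x * y + x * y ≤ x * x + y * y
    ordered {x} {y} x≤y with ≤⇒difference x≤y
    ... | d , 0≤d , y≈ = begin
      x * y + x * y              ≈⟨ +-cong (*-congˡ y≈) (*-congˡ y≈) ⟩
      x * (x + d) + x * (x + d)  ≤⟨ certify (*-nonNeg 0≤d 0≤d) (solve 2 (λ x d →
        x :* (x :+ d) :+ x :* (x :+ d) :+ d :* d := x :* x :+ (x :+ d) :* (x :+ d) :+ con 0) refl x d) ⟩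
      x * x + (x + d) * (x + d)  ≈⟨ +-congˡ (*-cong y≈ y≈) ⟨
      x * x + y * y              ∎
      where open ≤-Reasoning
  ... | inj₂ y≤x with ≤⇒difference y≤x
  ... | d , 0≤d , x≈ = begin
      x * y + x * y              ≈⟨ +-cong (*-congʳ x≈) (*-congʳ x≈) ⟩
      (y + d) * y + (y + d) * y  ≤⟨ certify (*-nonNeg 0≤d 0≤d) (solve 2 (λ x d →
        (x :+ d) :* x :+ (x :+ d) :* x :+ d :* d := (x :+ d) :* (x :+ d) :+ x :* x :+ con 0) refl y d) ⟩
      (y + d) * (y + d) + y * y  ≈⟨ +-congʳ (*-cong x≈ x≈) ⟨
      x * x + y * y              ∎
      where open ≤-Reasoning

  0≤x+y : ∀ {x y} → 0# ≤ x → 0# ≤ y → 0# ≤ x + y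
  0≤x+y 0≤x 0≤y = ≤-trans (≤-reflexive (sym (+-identityˡ 0#))) (0≤x ⊕ 0≤y)

  y≤x+y : ∀ {x y} → 0# ≤ x → y ≤ x + y
  y≤x+y {x} {y} 0≤x = ≤-trans (≤-reflexive (sym (+-identityˡ y))) (+-monoˡ-≤ y 0≤x)

  ≰⇒≥ : ∀ {x y} → ¬ (x ≤ y) → y ≤ x
  ≰⇒≥ {x} {y} x≰y with ≤-total x y
  ... | inj₁ x≤y = contradiction x≤y x≰y
  ... | inj₂ y≤x = y≤x

  x-y+y : ∀ x y → x - y + y ≈ x
  x-y+y x y = trans (+-assoc x (- y) y) (trans (+-congˡ (-‿inverseˡ y)) (+-identityʳ x))

  0≤1 : 0# ≤ 1#
  0≤1 with ≤-total 0# 1#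
  ... | inj₁ le = le
  ... | inj₂ 1≤0 = certify (2xy≤x²+y² 0# 1#)
      (solve 0 (con 0 :+ (con 0 :* con 0 :+ con 1 :* con 1)
             := con 1 :+ (con 0 :* con 1 :+ con 0 :* con 1)) refl)

  fromℕ-nonNeg : ∀ n → 0# ≤ fromℕ n
  fromℕ-nonNeg ℕ.zero    = ≤-refl
  fromℕ-nonNeg (ℕ.suc n) = 0≤x+y 0≤1 (fromℕ-nonNeg n)

  fromℕ-mono-≤ : ∀ {m n} → m ℕ.≤ n → fromℕ m ≤ fromℕ n
  fromℕ-mono-≤ {n = n} ℕ.z≤n = fromℕ-nonNeg n
  fromℕ-mono-≤ (ℕ.s≤s m≤n)   = +-monoʳ-≤ 1# (fromℕ-mono-≤ m≤n)

  fromℕ-≰ : ∀ {m n} → m ℕ.< n → ¬ (fromℕ n ≤ fromℕ m)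
  fromℕ-≰ {m} m<n le = 0≉1 (≤-antisym 0≤1 (+-cancelʳ-≤ (fromℕ m)
    (≤-trans (fromℕ-mono-≤ m<n) (≤-trans le (≤-reflexive (sym (+-identityˡ _)))))))

  positive⇒≉0 : ∀ n {x} → fromℕ (ℕ.suc n) ≤ x → ¬ (x ≈ 0#)
  positive⇒≉0 n le x≈0 = fromℕ-≰ {0} {ℕ.suc n} (ℕ.s≤s ℕ.z≤n) (≤-trans le (≤-reflexive x≈0))

  fromℕ-≉0 : ∀ n → ¬ (fromℕ (ℕ.suc n) ≈ 0#)
  fromℕ-≉0 n = positive⇒≉0 n ≤-refl

  fromℕ-* : ∀ m n → fromℕ (m ℕ.* n) ≈ fromℕ m * fromℕ n
  fromℕ-* = Mult.×1-homo-* semiring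

  fromℕ-+ : ∀ m n → fromℕ (m ℕ.+ n) ≈ fromℕ m + fromℕ n
  fromℕ-+ = Mult.×-homo-+ semiring 1#

  -- The strict inequality of squares is a negated `≤`, so that a bound on √6 is proved by refuting
  -- a comparison of numerals with `fromℕ-≰`.
  x²<y²⇒x≤y : ∀ {x y} → 0# ≤ y → ¬ (y * y ≤ x * x) → x ≤ y
  x²<y²⇒x≤y {x} {y} 0≤y y²≰x² with ≤-total x y
  ... | inj₁ x≤y = x≤y
  ... | inj₂ y≤x = contradiction (≤-trans (*-monoˡ-≤ 0≤y y≤x) (*-monoʳ-≤ (≤-trans 0≤y y≤x) y≤x)) y²≰x²

-- Numerical bounds on √6 and ρ.

module Numerics {c ℓ₁ ℓ₂} (K : OrderedField c ℓ₁ ℓ₂) where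
  open OrderedField K
  open OrderedFieldProperties K

  ≤-fraction : ∀ {x} m k → fromℕ (ℕ.suc k) * x ≤ fromℕ m → x ≤ fromℕ m / fromℕ (ℕ.suc k)
  ≤-fraction m k le = *-cancelˡ-≤ (fromℕ-nonNeg (ℕ.suc k)) (fromℕ-≉0 k)
    (≤-trans le (≤-reflexive (trans (sym (/-*-cancel (fromℕ m) (fromℕ-≉0 k))) (*-comm _ _))))

  -- 4801 / 1960 is a convergent of √6.
  sqrt6-upper : ∀ {s} → IsSqrt (fromℕ 6) s → fromℕ 1960 * s ≤ fromℕ 4801
  sqrt6-upper {s} s-sqrt = x²<y²⇒x≤y (fromℕ-nonNeg 4801) λ le →
    -- 4801² = 6 · 1960² + 1, so this comparison of naturals holds with the least possible margin.
    -- It is decided by evaluation in `ℕ`.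
    fromℕ-≰ {1960 ℕ.* 1960 ℕ.* 6} {4801 ℕ.* 4801} (ℕₚ.≤ᵇ⇒≤ _ _ tt) (begin
      fromℕ (4801 ℕ.* 4801)                   ≈⟨ fromℕ-* 4801 4801 ⟩
      fromℕ 4801 * fromℕ 4801                 ≤⟨ le ⟩
      fromℕ 1960 * s * (fromℕ 1960 * s)       ≈⟨ square-* (fromℕ 1960) s ⟩
      fromℕ 1960 * fromℕ 1960 * (s * s)       ≈⟨ *-cong (sym (fromℕ-* 1960 1960)) (IsSqrt.square s-sqrt) ⟩
      fromℕ (1960 ℕ.* 1960) * fromℕ 6         ≈⟨ fromℕ-* (1960 ℕ.* 1960) 6 ⟨
      fromℕ (1960 ℕ.* 1960 ℕ.* 6)             ∎)
    where
    open ≤-Reasoning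
    square-* : ∀ x y → x * y * (x * y) ≈ x * x * (y * y)
    square-* = solve 2 (λ x y → x :* y :* (x :* y) := x :* x :* (y :* y)) refl

  ρ-upper : ∀ {s ρ} → IsSqrt (fromℕ 6) s → fromℕ 20 * ρ ≈ fromℕ 3 * (fromℕ 7 + fromℕ 3 * s) →
            ρ ≤ fromℕ 2152271 / fromℕ 1000000
  ρ-upper {s} {ρ} s-sqrt 20ρ =
    -- The denominator 1000000 is passed as its predecessor. The factor 39200 = 1960 · 20 clears the
    -- denominators of the bound on √6 and of ρ, so that a comparison of naturals remains.
    ≤-fraction 2152271 999999 (*-cancelˡ-≤ (fromℕ-nonNeg 39200) (fromℕ-≉0 39199) (begin
    fromℕ 39200 * (fromℕ 1000000 * ρ)
      ≈⟨ *-congʳ (fromℕ-* 1960 20) ⟩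
    fromℕ 1960 * fromℕ 20 * (fromℕ 1000000 * ρ)
      ≈⟨ solve 4 (λ a b m ρ → a :* b :* (m :* ρ) := m :* (a :* (b :* ρ))) refl
                 (fromℕ 1960) (fromℕ 20) (fromℕ 1000000) ρ ⟩
    fromℕ 1000000 * (fromℕ 1960 * (fromℕ 20 * ρ))
      ≈⟨ *-congˡ (*-congˡ 20ρ) ⟩
    fromℕ 1000000 * (fromℕ 1960 * (fromℕ 3 * (fromℕ 7 + fromℕ 3 * s)))
      ≈⟨ *-congˡ (solve 2 (λ a s → a :* (num 3 :* (num 7 :+ num 3 :* s)) := a :* num 21 :+ num 9 :* (a :* s))
                 refl (fromℕ 1960) s) ⟩
    fromℕ 1000000 * (fromℕ 1960 * fromℕ 21 + fromℕ 9 * (fromℕ 1960 * s))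
      ≤⟨ *-monoˡ-≤ (fromℕ-nonNeg 1000000)
           (+-monoʳ-≤ (fromℕ 1960 * fromℕ 21) (*-monoˡ-≤ (fromℕ-nonNeg 9) (sqrt6-upper s-sqrt))) ⟩
    fromℕ 1000000 * (fromℕ 1960 * fromℕ 21 + fromℕ 9 * fromℕ 4801)
      ≈⟨ *-congˡ (+-cong (fromℕ-* 1960 21) (fromℕ-* 9 4801)) ⟨
    fromℕ 1000000 * (fromℕ (1960 ℕ.* 21) + fromℕ (9 ℕ.* 4801))
      ≈⟨ *-congˡ (fromℕ-+ (1960 ℕ.* 21) (9 ℕ.* 4801)) ⟨
    fromℕ 1000000 * fromℕ (1960 ℕ.* 21 ℕ.+ 9 ℕ.* 4801)
      ≈⟨ fromℕ-* 1000000 (1960 ℕ.* 21 ℕ.+ 9 ℕ.* 4801) ⟨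
    fromℕ (1000000 ℕ.* (1960 ℕ.* 21 ℕ.+ 9 ℕ.* 4801))
      ≤⟨ fromℕ-mono-≤ (ℕₚ.≤ᵇ⇒≤ (1000000 ℕ.* (1960 ℕ.* 21 ℕ.+ 9 ℕ.* 4801)) (39200 ℕ.* 2152271) tt) ⟩
    fromℕ (39200 ℕ.* 2152271)
      ≈⟨ fromℕ-* 39200 2152271 ⟩
    fromℕ 39200 * fromℕ 2152271 ∎))
    where open ≤-Reasoning

-- The choice of the testing probability

module Ratio {c ℓ₁ ℓ₂} (K : OrderedField c ℓ₁ ℓ₂) where
  open OrderedField K
  open OrderedFieldProperties K
  open Scheduling K using (testProbability)

  module _ {s ρ} (s-sqrt : IsSqrt (fromℕ 6) s) (20ρ : fromℕ 20 * ρ ≈ fromℕ 3 * (fromℕ 7 + fromℕ 3 * s)) where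
    open IsSqrt s-sqrt renaming (nonNeg to 0≤s; square to s²≈6)

    -- Holds because 49 < 54 = (3√6)². It makes ρ at least 2 and the leading coefficient in
    -- `tangent` positive.
    7≤3s : fromℕ 7 ≤ fromℕ 3 * s
    7≤3s = x²<y²⇒x≤y (*-nonNeg (fromℕ-nonNeg 3) 0≤s) λ le →
      fromℕ-≰ {49} {54} (ℕₚ.≤ᵇ⇒≤ 50 54 tt) (begin
        fromℕ 54                     ≈⟨ fromℕ-* 9 6 ⟩
        fromℕ 9 * fromℕ 6            ≈⟨ *-congˡ s²≈6 ⟨
        fromℕ 9 * (s * s)            ≈⟨ solve 1 (λ s → num 9 :* (s :* s) := num 3 :* s :* (num 3 :* s)) refl s ⟩
        fromℕ 3 * s * (fromℕ 3 * s)  ≤⟨ le ⟩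
        fromℕ 7 * fromℕ 7            ≈⟨ fromℕ-* 7 7 ⟨
        fromℕ 49                     ∎)
      where open ≤-Reasoning

    2≤ρ : fromℕ 2 ≤ ρ
    2≤ρ = *-cancelˡ-≤ (fromℕ-nonNeg 20) (fromℕ-≉0 19) (certify
      (*-monoˡ-≤ (fromℕ-nonNeg 3) 7≤3s ⊕ ≤-reflexive (sym 20ρ) ⊕ fromℕ-nonNeg 2)
      (solve 2 (λ s ρ → num 20 :* num 2 :+ (num 3 :* (num 3 :* s) :+ num 20 :* ρ :+ num 2)
                     := num 20 :* ρ :+ (num 3 :* num 7 :+ num 3 :* (num 7 :+ num 3 :* s) :+ con 0)) refl s ρ))

    0≤ρ : 0# ≤ ρ
    0≤ρ = ≤-trans (fromℕ-nonNeg 2) 2≤ρ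

    -- The quadratic c r² − (6 + 4s) r + 7 + 3s has discriminant 0: c times
    -- it is (c r − (2s + 3))².
    tangent : ∀ {c} r → c + fromℕ 3 ≈ fromℕ 3 * s →
              (fromℕ 6 + fromℕ 4 * s) * r ≤ c * (r * r) + (fromℕ 7 + fromℕ 3 * s)
    tangent {c} r c+3 = *-cancelˡ-≤ (≤-trans (fromℕ-nonNeg 4) 4≤c) (positive⇒≉0 3 4≤c) (certify
        (2xy≤x²+y² (c * r) (fromℕ 2 * s + fromℕ 3)
          ⊕ ≤-reflexive (*-congʳ {fromℕ 7 + fromℕ 3 * s} (sym c+3))
          ⊕ ≤-reflexive (*-congˡ {fromℕ 5} (sym s²≈6)))
        (solve 3 (λ c r s →
            c :* ((num 6 :+ num 4 :* s) :* r) :+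
              (c :* r :* (c :* r) :+ (num 2 :* s :+ num 3) :* (num 2 :* s :+ num 3)
                :+ (c :+ num 3) :* (num 7 :+ num 3 :* s) :+ num 5 :* (s :* s))
          := c :* (c :* (r :* r) :+ (num 7 :+ num 3 :* s)) :+
              (c :* r :* (num 2 :* s :+ num 3) :+ c :* r :* (num 2 :* s :+ num 3)
                :+ num 3 :* s :* (num 7 :+ num 3 :* s) :+ num 5 :* num 6)) refl c r s))
      where
      4≤c : fromℕ 4 ≤ c
      4≤c = certify (7≤3s ⊕ ≤-reflexive (sym c+3))
        (solve 2 (λ c s → num 4 :+ (num 3 :* s :+ (c :+ num 3)) := c :+ (num 7 :+ num 3 :* s)) refl c s)

    -- With d = 3r² - 4r + 3, ten times the difference of the sides is nine times the quadratic of
    -- `tangent` for c = 3√6 - 3. Its double root is what determines ρ.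
    quadratic : ∀ {d} r → d + fromℕ 4 * r ≈ fromℕ 3 * (r * r) + fromℕ 3 →
                fromℕ 9 * (r * r) ≤ fromℕ 2 * ρ * d + fromℕ 3 * r
    quadratic {d} r d+4r = *-cancelˡ-≤ (fromℕ-nonNeg 10) (fromℕ-≉0 9) (certify
        (*-monoˡ-≤ (fromℕ-nonNeg 9) (tangent r w+3)
          ⊕ ≤-reflexive (*-congˡ {fromℕ 3 * (fromℕ 7 + fromℕ 3 * s)} (sym d+4r))
          ⊕ ≤-reflexive (*-congʳ {d} (sym 20ρ))
          ⊕ ≤-reflexive (*-congˡ {fromℕ 9 * (r * r)} w+3))
        (solve 5 (λ w d r s ρ →
            num 10 :* (num 9 :* (r :* r)) :+
              (num 9 :* (w :* (r :* r) :+ (num 7 :+ num 3 :* s))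
                :+ num 3 :* (num 7 :+ num 3 :* s) :* (d :+ num 4 :* r)
                :+ num 20 :* ρ :* d
                :+ num 9 :* (r :* r) :* (num 3 :* s))
          := num 10 :* (num 2 :* ρ :* d :+ num 3 :* r) :+
              (num 9 :* ((num 6 :+ num 4 :* s) :* r)
                :+ num 3 :* (num 7 :+ num 3 :* s) :* (num 3 :* (r :* r) :+ num 3)
                :+ num 3 :* (num 7 :+ num 3 :* s) :* d
                :+ num 9 :* (r :* r) :* (w :+ num 3))) refl w d r s ρ))
      where
      w = fromℕ 3 * s - fromℕ 3
      w+3 : w + fromℕ 3 ≈ fromℕ 3 * s
      w+3 = x-y+y (fromℕ 3 * s) (fromℕ 3)

  -- π is the testing probability of a job with r = u / t.
  data Testing (ρ r π : Carrier) : Set (c ⊔ ℓ₁ ⊔ ℓ₂) where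
    never     : r ≤ 1# → π ≈ 0# → Testing ρ r π
    sometimes : 1# ≤ r → 0# ≤ π → 0# ≤ 1# - π →
                fromℕ 4 * π + fromℕ 3 * (1# - π) * r ≤ fromℕ 2 * ρ →
                fromℕ 3 * r + fromℕ 3 * π ≤ fromℕ 2 * ρ * r →
                Testing ρ r π

  testing-probability : ∀ {ρ r π} → Testing ρ r π → 0# ≤ π × 0# ≤ 1# - π
  testing-probability {π = π} (never _ π≈0) = ≤-reflexive (sym π≈0) ,
    certify (0≤1 ⊕ ≤-reflexive π≈0 ⊕ ≤-reflexive (sym (x-y+y 1# π)))
      (solve 2 (λ π q → con 0 :+ (con 1 :+ con 0 :+ (q :+ π)) := q :+ (con 0 :+ π :+ con 1)) refl π (1# - π))
  testing-probability (sometimes _ 0≤π 0≤1-π _ _) = 0≤π , 0≤1-π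

  module _ {s ρ} (s-sqrt : IsSqrt (fromℕ 6) s) (20ρ : fromℕ 20 * ρ ≈ fromℕ 3 * (fromℕ 7 + fromℕ 3 * s)) where

    -- Everything is multiplied by the denominator `d`, where d π = 3r² - 3r and d (1 - π) = 3 - r.
    -- The left sides of the last two conditions of `sometimes` then become 9r² - 3r and r (9r² -
    -- 3r), so this π makes both of them instances of `quadratic`.
    fraction : ∀ {r} → 1# ≤ r → r ≤ fromℕ 3 →
               Testing ρ r ((fromℕ 3 * (r * r) - fromℕ 3 * r) / (fromℕ 3 * (r * r) - fromℕ 4 * r + fromℕ 3))
    fraction {r} 1≤r r≤3 = sometimes 1≤r
      (*-cancelˡ-≤ 0≤d d≉0 (certify (n≤dπ ⊕ 3r²≤n+3r ⊕ *-monoˡ-≤ 0≤r (*-monoˡ-≤ (fromℕ-nonNeg 3) 1≤r))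
        (solve 4 (λ d n π r →
          d :* con 0 :+ (d :* π :+ (n :+ num 3 :* r) :+ r :* (num 3 :* r))
            := d :* π :+ (n :+ num 3 :* (r :* r) :+ r :* (num 3 :* con 1))) refl d n π r)))
      (*-cancelˡ-≤ 0≤d d≉0 (certify (d≤dq+dπ ⊕ dπ≤n ⊕ n+3r≤3r² ⊕ 3r²+3≤d+4r ⊕ r≤3)
        (solve 5 (λ d n π q r →
          d :* con 0 :+ (d :* q :+ d :* π :+ n :+ num 3 :* (r :* r) :+ (d :+ num 4 :* r) :+ num 3)
            := d :* q :+ (d :+ d :* π :+ (n :+ num 3 :* r) :+ (num 3 :* (r :* r) :+ num 3) :+ r))
          refl d n π q r)))
      (*-cancelˡ-≤ 0≤d d≉0 (certify
        (quadratic s-sqrt 20ρ r d+4r ⊕ *-monoˡ-≤ (fromℕ-nonNeg 4) dπ≤n ⊕ *-monoˡ-≤ (fromℕ-nonNeg 4) n+3r≤3r²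
          ⊕ *-monoˡ-≤ (*-nonNeg (fromℕ-nonNeg 3) 0≤r) dq+r≤3)
        (solve 6 (λ d n π q r ρ →
          d :* (num 4 :* π :+ num 3 :* q :* r) :+
            (num 2 :* ρ :* d :+ num 3 :* r :+ num 4 :* n :+ num 4 :* (num 3 :* (r :* r)) :+ num 3 :* r :* num 3)
          := d :* (num 2 :* ρ) :+
            (num 9 :* (r :* r) :+ num 4 :* (d :* π) :+ num 4 :* (n :+ num 3 :* r)
              :+ num 3 :* r :* (d :* q :+ r))) refl d n π q r ρ)))
      (*-cancelˡ-≤ 0≤d d≉0 (certify
        (*-monoˡ-≤ 0≤r (quadratic s-sqrt 20ρ r d+4r) ⊕ *-monoˡ-≤ (fromℕ-nonNeg 3) dπ≤n
          ⊕ *-monoˡ-≤ (fromℕ-nonNeg 3) n+3r≤3r² ⊕ *-monoˡ-≤ (*-nonNeg (fromℕ-nonNeg 3) 0≤r) d+4r≤3r²+3)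
        (solve 5 (λ d n π r ρ →
          d :* (num 3 :* r :+ num 3 :* π) :+
            (r :* (num 2 :* ρ :* d :+ num 3 :* r) :+ num 3 :* n :+ num 3 :* (num 3 :* (r :* r))
              :+ num 3 :* r :* (num 3 :* (r :* r) :+ num 3))
          := d :* (num 2 :* ρ :* r) :+
            (r :* (num 9 :* (r :* r)) :+ num 3 :* (d :* π) :+ num 3 :* (n :+ num 3 :* r)
              :+ num 3 :* r :* (d :+ num 4 :* r))) refl d n π r ρ)))
      where
      n = fromℕ 3 * (r * r) - fromℕ 3 * r
      d = fromℕ 3 * (r * r) - fromℕ 4 * r + fromℕ 3
      π = n / d
      q = 1# - π

      0≤r : 0# ≤ r
      0≤r = ≤-trans 0≤1 1≤r

      n+3r : n + fromℕ 3 * r ≈ fromℕ 3 * (r * r)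
      n+3r = x-y+y _ _

      d+4r : d + fromℕ 4 * r ≈ fromℕ 3 * (r * r) + fromℕ 3
      d+4r = trans (solve 3 (λ x y z → x :+ y :+ z := x :+ z :+ y) refl _ _ _) (+-congʳ (x-y+y _ _))

      5≤3d : fromℕ 5 ≤ fromℕ 3 * d
      -- 3d - 5 = (3r - 2)².
      5≤3d = certify (2xy≤x²+y² (fromℕ 3 * r) (fromℕ 2) ⊕ *-monoˡ-≤ (fromℕ-nonNeg 3) (≤-reflexive (sym d+4r)))
        (solve 2 (λ d r →
          num 5 :+ (num 3 :* r :* (num 3 :* r) :+ num 2 :* num 2 :+ num 3 :* (d :+ num 4 :* r))
            := num 3 :* d :+ (num 3 :* r :* num 2 :+ num 3 :* r :* num 2
                               :+ num 3 :* (num 3 :* (r :* r) :+ num 3))) refl d r)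

      0≤d : 0# ≤ d
      0≤d = *-cancelˡ-≤ (fromℕ-nonNeg 3) (fromℕ-≉0 2)
        (≤-trans (≤-reflexive (zeroʳ (fromℕ 3))) (≤-trans (fromℕ-nonNeg 5) 5≤3d))

      d≉0 : ¬ (d ≈ 0#)
      d≉0 d≈0 = positive⇒≉0 4 5≤3d (trans (*-congˡ d≈0) (zeroʳ (fromℕ 3)))

      dπ≈n : d * π ≈ n
      dπ≈n = trans (*-comm d π) (/-*-cancel n d≉0)

      dq+dπ≈d : d * q + d * π ≈ d
      dq+dπ≈d = trans (sym (distribˡ d q π)) (trans (*-congˡ (x-y+y 1# π)) (*-identityʳ d))

      n≤dπ = ≤-reflexive (sym dπ≈n)
      dπ≤n = ≤-reflexive dπ≈n
      n+3r≤3r² = ≤-reflexive n+3r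
      3r²≤n+3r = ≤-reflexive (sym n+3r)
      d≤dq+dπ = ≤-reflexive (sym dq+dπ≈d)
      3r²+3≤d+4r = ≤-reflexive (sym d+4r)
      d+4r≤3r²+3 = ≤-reflexive d+4r

      dq+r≤3 : d * q + r ≤ fromℕ 3
      dq+r≤3 = certify (≤-reflexive dq+dπ≈d ⊕ n≤dπ ⊕ d+4r≤3r²+3 ⊕ 3r²≤n+3r)
        (solve 5 (λ d n π q r →
          d :* q :+ r :+ (d :+ d :* π :+ (num 3 :* (r :* r) :+ num 3) :+ (n :+ num 3 :* r))
            := num 3 :+ (d :* q :+ d :* π :+ n :+ (d :+ num 4 :* r) :+ num 3 :* (r :* r))) refl d n π q r)

    -- With π = 1 the two conditions are 4 ≤ 2ρ and 3r + 3 ≤ 2ρ r. Both follow from ρ ≥ 2, the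
    -- second because 3 ≤ r.
    always : ∀ {r} → fromℕ 3 ≤ r → Testing ρ r 1#
    always {r} 3≤r = sometimes (≤-trans 1≤3 3≤r) 0≤1 (≤-reflexive (sym 1-1≈0))
        (certify (*-monoˡ-≤ (fromℕ-nonNeg 2) (2≤ρ s-sqrt 20ρ) ⊕ ≤-reflexive (*-congˡ {fromℕ 3 * r} 1-1≈0))
          (solve 3 (λ q r ρ → num 4 :* con 1 :+ num 3 :* q :* r :+ (num 2 :* ρ :+ num 3 :* r :* con 0)
                           := num 2 :* ρ :+ (num 2 :* num 2 :+ num 3 :* r :* q)) refl (1# - 1#) r ρ))
        (certify (*-monoˡ-≤ (≤-trans (fromℕ-nonNeg 3) 3≤r) (*-monoˡ-≤ (fromℕ-nonNeg 2) (2≤ρ s-sqrt 20ρ)) ⊕ 3≤r)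
          (solve 2 (λ r ρ → num 3 :* r :+ num 3 :* con 1 :+ (r :* (num 2 :* ρ) :+ r)
                         := num 2 :* ρ :* r :+ (r :* (num 2 :* num 2) :+ num 3)) refl r ρ))
      where
      1≤3 : 1# ≤ fromℕ 3
      1≤3 = ≤-trans (≤-reflexive (sym (+-identityʳ 1#))) (fromℕ-mono-≤ {1} {3} (ℕ.s≤s ℕ.z≤n))
      1-1≈0 = -‿inverseʳ 1#

    testing : ∀ r → Testing ρ r (testProbability r)
    testing r with 1# ≤? r
    ... | no 1≰r = never (≰⇒≥ 1≰r) refl
    ... | yes 1≤r with r ≤? fromℕ 3
    ...   | yes r≤3 = fraction 1≤r r≤3
    ...   | no r≰3  = always (≰⇒≥ r≰3)

    -- All charges are doubled to avoid halves: `v` dominates both charges of a tested job, and 3u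
    -- is the charge of an untested one. The two final bounds together bound the mean by 2ρ min(t +
    -- p, u). In each case one of them is proved directly and the other follows by monotonicity.
    budget : ∀ {t u p π} → 0# < t → 0# ≤ u → 0# ≤ p → p ≤ u → Testing ρ (u / t) π →
             ∃[ v ] fromℕ 3 * (t + p) ≤ v × fromℕ 2 * (t + (t + p)) ≤ v ×
                    π * v + (1# - π) * (fromℕ 3 * u) ≤ fromℕ 2 * ρ * (t + p) ×
                    π * v + (1# - π) * (fromℕ 3 * u) ≤ fromℕ 2 * ρ * u
    budget {t} {u} {p} {π} (0≤t , 0≉t) 0≤u 0≤p p≤u = choose
      where
      r = u / t
      q = 1# - π

      rt≈u : r * t ≈ u
      rt≈u = /-*-cancel u (λ t≈0 → 0≉t (sym t≈0))

      q+π≈1 : q + π ≈ 1#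
      q+π≈1 = x-y+y 1# π

      0≤2ρ : 0# ≤ fromℕ 2 * ρ
      0≤2ρ = *-nonNeg (fromℕ-nonNeg 2) (0≤ρ s-sqrt 20ρ)

      t≤t+p : t ≤ t + p
      t≤t+p = ≤-trans (≤-reflexive (sym (+-identityʳ t))) (+-monoʳ-≤ t 0≤p)

      choose : Testing ρ r π → _
      -- Since π is 0, `v` carries no weight and may be the sum of the two charges. The mean is 3u,
      -- which ρ ≥ 2 covers.
      choose (never r≤1 π≈0) = v ,
          certify (*-nonNeg (fromℕ-nonNeg 2) (0≤x+y 0≤t (≤-trans 0≤t t≤t+p)))
            (solve 2 (λ t p → num 3 :* (t :+ p) :+ num 2 :* (t :+ (t :+ p))
                           := num 3 :* (t :+ p) :+ num 2 :* (t :+ (t :+ p)) :+ con 0) refl t p) ,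
          certify (*-nonNeg (fromℕ-nonNeg 3) (≤-trans 0≤t t≤t+p))
            (solve 2 (λ t p → num 2 :* (t :+ (t :+ p)) :+ num 3 :* (t :+ p)
                           := num 3 :* (t :+ p) :+ num 2 :* (t :+ (t :+ p)) :+ con 0) refl t p) ,
          ≤-trans mean≤2ρu (*-monoˡ-≤ 0≤2ρ (≤-trans u≤t t≤t+p)) ,
          mean≤2ρu
        where
        v = fromℕ 3 * (t + p) + fromℕ 2 * (t + (t + p))

        u≤t : u ≤ t
        u≤t = ≤-trans (≤-reflexive (sym rt≈u)) (≤-trans (*-monoʳ-≤ 0≤t r≤1) (≤-reflexive (*-identityˡ t)))

        mean≤2ρu = certify
          (≤-reflexive (*-congʳ {v} π≈0) ⊕ ≤-reflexive (*-congˡ {fromℕ 3 * u} q+π≈1)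
            ⊕ ≤-reflexive (*-congˡ {fromℕ 3 * u} (sym π≈0))
            ⊕ *-monoˡ-≤ 0≤u (*-monoˡ-≤ (fromℕ-nonNeg 2) (2≤ρ s-sqrt 20ρ)) ⊕ 0≤u)
          (solve 5 (λ u v π q ρ →
            π :* v :+ q :* (num 3 :* u) :+
              (con 0 :* v :+ num 3 :* u :* con 1 :+ num 3 :* u :* π :+ u :* (num 2 :* ρ) :+ u)
            := num 2 :* ρ :* u :+
              (π :* v :+ num 3 :* u :* (q :+ π) :+ num 3 :* u :* con 0 :+ u :* (num 2 :* num 2) :+ con 0))
            refl u v π q ρ)
      choose (sometimes 1≤r 0≤π 0≤q small large) with ≤-total (t + p) u
      -- The minimum is t + p. The mean is affine in p: `small` pays for the part at p = 0, and the
      -- growth rate 4π is at most 2ρ.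
      ... | inj₁ t+p≤u = fromℕ 4 * (t + p) ,
          *-monoʳ-≤ (≤-trans 0≤t t≤t+p) (fromℕ-mono-≤ {3} {4} (ℕₚ.n≤1+n 3)) ,
          certify (*-nonNeg (fromℕ-nonNeg 2) 0≤p)
            (solve 2 (λ t p → num 2 :* (t :+ (t :+ p)) :+ num 2 :* p := num 4 :* (t :+ p) :+ con 0) refl t p) ,
          mean≤2ρ[t+p] ,
          ≤-trans mean≤2ρ[t+p] (*-monoˡ-≤ 0≤2ρ t+p≤u)
        where
        4π≤2ρ : fromℕ 4 * π ≤ fromℕ 2 * ρ
        4π≤2ρ = certify (small ⊕ *-nonNeg (*-nonNeg (fromℕ-nonNeg 3) 0≤q) (≤-trans 0≤1 1≤r))
          (solve 4 (λ r π q ρ → num 4 :* π :+ (num 2 :* ρ :+ num 3 :* q :* r)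
                             := num 2 :* ρ :+ (num 4 :* π :+ num 3 :* q :* r :+ con 0)) refl r π q ρ)

        mean≤2ρ[t+p] = certify
          (*-monoˡ-≤ 0≤t small ⊕ *-monoˡ-≤ 0≤p 4π≤2ρ ⊕ ≤-reflexive (*-congˡ {fromℕ 3 * q} (sym rt≈u)))
          (solve 7 (λ t u p r π q ρ →
            π :* (num 4 :* (t :+ p)) :+ q :* (num 3 :* u) :+
              (t :* (num 2 :* ρ) :+ p :* (num 2 :* ρ) :+ num 3 :* q :* (r :* t))
            := num 2 :* ρ :* (t :+ p) :+
              (t :* (num 4 :* π :+ num 3 :* q :* r) :+ p :* (num 4 :* π) :+ num 3 :* q :* u))
            refl t u p r π q ρ)
      -- The minimum is u. Replacing p by its largest value u gives a `v` that also dominates 2 (t +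
      -- (t + p)) because t ≤ u; the mean becomes t (3r + 3π), the left side of `large` times t.
      ... | inj₂ u≤t+p = fromℕ 3 * (t + u) ,
          *-monoˡ-≤ (fromℕ-nonNeg 3) (+-monoʳ-≤ t p≤u) ,
          certify (t≤u ⊕ *-monoˡ-≤ (fromℕ-nonNeg 2) p≤u)
            (solve 3 (λ t u p → num 2 :* (t :+ (t :+ p)) :+ (u :+ num 2 :* u)
                             := num 3 :* (t :+ u) :+ (t :+ num 2 :* p)) refl t u p) ,
          ≤-trans mean≤2ρu (*-monoˡ-≤ 0≤2ρ u≤t+p) ,
          mean≤2ρu
        where
        t≤u : t ≤ u
        t≤u = ≤-trans (≤-reflexive (sym (*-identityˡ t))) (≤-trans (*-monoʳ-≤ 0≤t 1≤r) (≤-reflexive rt≈u))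

        mean≤2ρu = certify
          (*-monoˡ-≤ 0≤t large ⊕ ≤-reflexive (*-congˡ {fromℕ 2 * ρ} rt≈u)
            ⊕ ≤-reflexive (*-congˡ {fromℕ 3} (sym rt≈u)) ⊕ ≤-reflexive (*-congˡ {fromℕ 3 * u} q+π≈1))
          (solve 6 (λ t u r π q ρ →
            π :* (num 3 :* (t :+ u)) :+ q :* (num 3 :* u) :+
              (t :* (num 2 :* ρ :* r) :+ num 2 :* ρ :* u :+ num 3 :* (r :* t) :+ num 3 :* u :* con 1)
            := num 2 :* ρ :* u :+
              (t :* (num 3 :* r :+ num 3 :* π) :+ num 2 :* ρ :* (r :* t) :+ num 3 :* u
                :+ num 3 :* u :* (q :+ π)))
            refl t u r π q ρ)

-- Tasks and executions

private variable
  ℓ : Level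
  n : ℕ
  i j : Fin n
  x y z : Task n
  q xs : List (Task n)

job : Task n → Fin n
job (test j)     = j
job (execute j)  = j
job (untested j) = j

entry : Bool → Fin n → Task n
entry b j = if b then test j else untested j

job-entry : ∀ b (j : Fin n) → job (entry b j) ≡ j
job-entry true  j = ≡.refl
job-entry false j = ≡.refl

finishes-other : (x : Task n) → job x ≢ j → finishes x j ≡ false
finishes-other (test i)     i≢j = ≡.refl
finishes-other (execute i)  i≢j = dec-false (i ≟ _) i≢j
finishes-other (untested i) i≢j = dec-false (i ≟ _) i≢j

Without : Fin n → List (Task n) → Set
Without j = All (λ x → job x ≢ j)

-- The queue invariant of a job: an unfinished job has exactly one available task, while a finished
-- one satisfies `Without`.
data Sole (j : Fin n) (x : Task n) : List (Task n) → Set where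
  here  : job x ≡ j → Without j q → Sole j x (x ∷ q)
  there : job y ≢ j → Sole j x q → Sole j x (y ∷ q)

Sole⇒∈ : Sole j x q → x ∈ q
Sole⇒∈ (here _ _)  = here ≡.refl
Sole⇒∈ (there _ s) = there (Sole⇒∈ s)

Sole⇒job : Sole j x q → job x ≡ j
Sole⇒job (here eq _)  = eq
Sole⇒job (there _ s) = Sole⇒job s

without-release : ∀ z → job z ≢ j → Without j q → Without j (release z q)
without-release (test _)     z≢j w = z≢j ∷ w
without-release (execute _)  z≢j w = w
without-release (untested _) z≢j w = w

sole-release : ∀ z → job z ≢ j → Sole j x q → Sole j x (release z q)
sole-release (test _)     z≢j s = there z≢j s
sole-release (execute _)  z≢j s = s
sole-release (untested _) z≢j s = s

sole-remove : Sole j x q → (z∈q : z ∈ q) →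
              (job z ≢ j × Sole j x (q ─ z∈q)) ⊎ (z ≡ x × Without j (q ─ z∈q))
sole-remove (here x≡j w) (here ≡.refl) = inj₂ (≡.refl , w)
sole-remove (here x≡j w) (there z∈q)   = inj₁ (All.lookup w z∈q , here x≡j (─⁺ z∈q w))
sole-remove (there y≢j s) (here ≡.refl) = inj₁ (y≢j , s)
sole-remove (there y≢j s) (there z∈q) with sole-remove s z∈q
... | inj₁ (z≢j , s′) = inj₁ (z≢j , there y≢j s′)
... | inj₂ (z≡x , w)  = inj₂ (z≡x , y≢j ∷ w)

sole-step : Sole j x q → (z∈q : z ∈ q) →
            (job z ≢ j × Sole j x (release z (q ─ z∈q))) ⊎ (z ≡ x × Without j (q ─ z∈q))
sole-step {z = z} s z∈q with sole-remove s z∈q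
... | inj₁ (z≢j , s′) = inj₁ (z≢j , sole-release z z≢j s′)
... | inj₂ own        = inj₂ own

own-step : ∀ z → job z ≡ j → Without j q →
           finishes z j ≡ true ⊎ (finishes z j ≡ false × ∃[ x ] Sole j x (release z q))
own-step         (test i)     i≡j w = inj₂ (≡.refl , execute i , here i≡j w)
own-step {j = j} (execute i)  i≡j w = inj₁ (dec-true (i ≟ j) i≡j)
own-step {j = j} (untested i) i≡j w = inj₁ (dec-true (i ≟ j) i≡j)

initial-sole : (T : Subset n) (j : Fin n) → Sole j (entry (lookup T j) j) (initial T)
-- The induction along the list replaces `f` by `f ∘ suc`, hence the generalisation from the
-- identity to an injective `f`.
initial-sole {n} T = among (λ i → i) (λ eq → eq)
  where
  task : Fin n → Task n
  task i = entry (lookup T i) i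

  job-task : ∀ i → job (task i) ≡ i
  job-task i = job-entry (lookup T i) i

  absent : ∀ {m} (f : Fin m → Fin n) → (∀ k → f k ≢ j) → Without j (map task (List.tabulate f))
  absent {m = ℕ.zero}  f f≢j = []
  absent {m = ℕ.suc m} f f≢j =
    (λ eq → f≢j zero (≡.trans (≡.sym (job-task (f zero))) eq)) ∷ absent (f ∘ suc) (f≢j ∘ suc)

  among : ∀ {m} (f : Fin m → Fin n) → (∀ {k l} → f k ≡ f l → k ≡ l) → ∀ k →
          Sole (f k) (task (f k)) (map task (List.tabulate f))
  among f f-inj zero    = here (job-task (f zero)) (absent (f ∘ suc) (λ k eq → case f-inj eq of λ ()))
  among f f-inj (suc k) =
    there (λ eq → case f-inj (≡.trans (≡.sym (job-task (f zero))) eq) of λ ())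
          (among (f ∘ suc) (suc-injective ∘ f-inj) k)

-- Accounting for the cost by pairs of jobs

module Accounting {c ℓ₁ ℓ₂} (K : OrderedField c ℓ₁ ℓ₂) {n} (I : Scheduling.Instance K n) where
  open OrderedField K
  open OrderedFieldProperties K
  open Sum +-commutativeMonoid using (sum; sum-cong-≋; ∑-distrib-+; ∑-comm; sum-replicate-zero)
  open Scheduling K
  open Instance I

  dur : Task n → Carrier
  dur = duration I

  -- At an initial task this is the full time of the job, with its test if it is to be tested.
  remaining : Task n → Carrier
  remaining (test j)     = t j + p j
  remaining (execute j)  = p j
  remaining (untested j) = u j

  share : Task n → Fin n → Carrier
  share x i = if does (job x ≟ i) then dur x else 0#

  -- The time spent on job i until job j completes.
  spent : List (Task n) → Fin n → Fin n → Carrier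
  spent []       i j = 0#
  spent (x ∷ xs) i j = share x i + (if finishes x j then 0# else spent xs i j)

  share-own : ∀ x → share x (job x) ≡ dur x
  share-own x = ≡.cong (λ b → if b then dur x else 0#) (dec-true (job x ≟ job x) ≡.refl)

  share-other : ∀ x {i} → job x ≢ i → share x i ≡ 0#
  share-other x {i} x≢i = ≡.cong (λ b → if b then dur x else 0#) (dec-false (job x ≟ i) x≢i)

  spent-continue : ∀ x xs {i j} → finishes x j ≡ false → spent (x ∷ xs) i j ≈ share x i + spent xs i j
  spent-continue x xs eq rewrite eq = refl

  spent-finish : ∀ x xs {i j} → finishes x j ≡ true → spent (x ∷ xs) i j ≈ share x i
  spent-finish x xs eq rewrite eq = +-identityʳ _

  spent-skip : ∀ x xs {i j} → job x ≢ i → job x ≢ j → spent (x ∷ xs) i j ≈ spent xs i j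
  spent-skip x xs {i} {j} x≢i x≢j = trans (spent-continue x xs (finishes-other x x≢j))
    (trans (+-congʳ (reflexive (share-other x x≢i))) (+-identityˡ _))

  spent-without : ∀ {Pick : Task n → List (Task n) → Set ℓ} {q xs i} →
                  Execution Pick q xs → Without i q → ∀ j → spent xs i j ≈ 0#
  spent-without [] w j = refl
  spent-without {xs = x ∷ xs} (step x∈q _ e) w j with All.lookup w x∈q
  ... | x≢i with finishes x j
  ...   | true  = trans (+-identityʳ _) (reflexive (share-other x x≢i))
  ...   | false = trans (+-cong (reflexive (share-other x x≢i))
                                (spent-without e (without-release x x≢i (─⁺ x∈q w)) j))
                        (+-identityˡ 0#)

  spent-own : ∀ {Pick : Task n → List (Task n) → Set ℓ} {q xs i x} →
              Execution Pick q xs → Sole i x q → spent xs i i ≈ remaining x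
  spent-own [] ()
  spent-own {xs = z ∷ xs} (step z∈q _ e) s with sole-step s z∈q
  ... | inj₁ (z≢i , s′) = trans (spent-skip z xs z≢i z≢i) (spent-own e s′)
  ... | inj₂ (≡.refl , w) with Sole⇒job s
  spent-own {xs = test i ∷ xs} (step z∈q _ e) s | inj₂ (≡.refl , w) | ≡.refl =
    +-cong (reflexive (share-own (test i))) (spent-own e (here ≡.refl w))
  spent-own {xs = execute i ∷ xs} (step z∈q _ e) s | inj₂ (≡.refl , w) | ≡.refl =
    trans (spent-finish (execute i) xs (dec-true (i ≟ i) ≡.refl)) (reflexive (share-own (execute i)))
  spent-own {xs = untested i ∷ xs} (step z∈q _ e) s | inj₂ (≡.refl , w) | ≡.refl =
    trans (spent-finish (untested i) xs (dec-true (i ≟ i) ≡.refl)) (reflexive (share-own (untested i)))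

  sum-indicator : ∀ {m} (k : Fin m) v → sum (λ i → if does (k ≟ i) then v else 0#) ≈ v
  sum-indicator {ℕ.suc m} zero v = trans (+-congˡ (sum-replicate-zero m)) (+-identityʳ v)
  sum-indicator (suc k)        v = trans (+-identityˡ _) (sum-indicator k v)

  -- The machine never idles, so the elapsed time splits according to the job being served. `Sole`
  -- ensures that `j` is still to finish, which keeps the recursion away from the junk value of
  -- `completionTime` at the empty list.
  completionTime-spent : ∀ {Pick : Task n → List (Task n) → Set ℓ} {q xs j x} →
                         Execution Pick q xs → Sole j x q → ∀ s →
                         completionTime I s xs j ≈ s + sum (λ i → spent xs i j)
  completionTime-spent [] () s
  completionTime-spent {xs = z ∷ xs} {j} (step z∈q _ e) sole s = go (sole-step sole z∈q)
    where
    finish : finishes z j ≡ true → completionTime I s (z ∷ xs) j ≈ s + sum (λ i → spent (z ∷ xs) i j)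
    finish eq rewrite eq = +-congˡ (sym
      (trans (sum-cong-≋ (λ i → +-identityʳ (share z i))) (sum-indicator (job z) (dur z))))

    continue : finishes z j ≡ false → ∀ {x} → Sole j x (release z (_ ─ z∈q)) →
               completionTime I s (z ∷ xs) j ≈ s + sum (λ i → spent (z ∷ xs) i j)
    continue eq sole′ rewrite eq = begin-equality
      completionTime I (s + dur z) xs j               ≈⟨ completionTime-spent e sole′ (s + dur z) ⟩
      s + dur z + sum (λ i → spent xs i j)            ≈⟨ +-assoc s (dur z) _ ⟩
      s + (dur z + sum (λ i → spent xs i j))          ≈⟨ +-congˡ (+-congʳ (sum-indicator (job z) (dur z))) ⟨
      s + (sum (share z) + sum (λ i → spent xs i j))  ≈⟨ +-congˡ (∑-distrib-+ (share z) _) ⟨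
      s + sum (λ i → share z i + spent xs i j)        ∎
      where open ≤-Reasoning

    go : _ → completionTime I s (z ∷ xs) j ≈ s + sum (λ i → spent (z ∷ xs) i j)
    go (inj₁ (z≢j , sole′)) = continue (finishes-other z z≢j) sole′
    go (inj₂ (z≡x , w)) with own-step z (≡.trans (≡.cong job z≡x) (Sole⇒job sole)) w
    ... | inj₁ eq               = finish eq
    ... | inj₂ (eq , _ , sole′) = continue eq sole′

  -- Doubling the cost allows one copy of the double sum to be transposed. The summand becomes
  -- symmetric in `i` and `j`, so there is no need to sum over i < j separately.
  cost-by-pairs : ∀ {Pick : Task n → List (Task n) → Set ℓ} T {xs} → Execution Pick (initial T) xs →
                  cost I xs + cost I xs ≈ sum (λ j → sum (λ i → spent xs i j + spent xs j i))
  cost-by-pairs T {xs} e = begin-equality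
    cost I xs + cost I xs
      ≈⟨ +-cong cost≈ cost≈ ⟩
    sum (λ j → sum (λ i → spent xs i j)) + sum (λ j → sum (λ i → spent xs i j))
      ≈⟨ +-congˡ (∑-comm (λ j i → spent xs i j)) ⟩
    sum (λ j → sum (λ i → spent xs i j)) + sum (λ j → sum (λ i → spent xs j i))
      ≈⟨ ∑-distrib-+ (λ j → sum (λ i → spent xs i j)) (λ j → sum (λ i → spent xs j i)) ⟨
    sum (λ j → sum (λ i → spent xs i j) + sum (λ i → spent xs j i))
      ≈⟨ sum-cong-≋ (λ j → ∑-distrib-+ (λ i → spent xs i j) (λ i → spent xs j i)) ⟨
    sum (λ j → sum (λ i → spent xs i j + spent xs j i))
      ∎
    where
    open ≤-Reasoning
    cost≈ : cost I xs ≈ sum (λ j → sum (λ i → spent xs i j))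
    cost≈ = sum-cong-≋ λ j → trans (completionTime-spent e (initial-sole T j) 0#) (+-identityˡ _)

  -- Runs of two jobs and what they charge to one of them.

  data Final : Task n → Set where
    execute  : ∀ j → Final (execute j)
    untested : ∀ j → Final (untested j)

  -- PairRun R x y d: two jobs whose next tasks are x and y can run, with
  -- every task z run while z′ is available satisfying R z z′, for total time d
  -- until one of the two jobs completes.
  data PairRun {ℓ} (R : Task n → Task n → Set ℓ) : Task n → Task n → Carrier → Set (c ⊔ ℓ) where
    finish₁ : ∀ {x y} → Final x → R x y → PairRun R x y (dur x)
    finish₂ : ∀ {x y} → Final y → R y x → PairRun R x y (dur y)
    test₁   : ∀ {i y d} → R (test i) y → PairRun R (execute i) y d → PairRun R (test i) y (t i + d)
    test₂   : ∀ {x j d} → R (test j) x → PairRun R x (execute j) d → PairRun R x (test j) (t j + d)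

  flip-run : ∀ {R : Task n → Task n → Set ℓ} {x y d} → PairRun R x y d → PairRun R y x d
  flip-run (finish₁ f r) = finish₂ f r
  flip-run (finish₂ f r) = finish₁ f r
  flip-run (test₁ r run) = test₂ r (flip-run run)
  flip-run (test₂ r run) = test₁ r (flip-run run)

  -- Once one of the jobs completes, the time spent on it no longer grows and
  -- the time spent on the other job no longer counts.
  module _ {Pick : Task n → List (Task n) → Set ℓ} {R : Task n → Task n → Set ℓ}
           (pick : ∀ {x y q} → Pick x q → y ∈ q → R x y) where

    PairSpent : List (Task n) → Fin n → Fin n → Task n → Task n → Set _
    PairSpent xs i j x y = ∃[ d ] PairRun R x y d × spent xs i j + spent xs j i ≈ d

    flip-spent : ∀ {xs i j x y} → PairSpent xs i j x y → PairSpent xs j i y x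
    flip-spent {xs} {i} {j} (d , run , eq) =
      d , flip-run run , trans (+-comm (spent xs j i) (spent xs i j)) eq

    pairRun-finish : ∀ x {q xs j y} → Execution Pick q xs → Final x → job x ≢ j → R x y →
                     Without (job x) q → PairSpent (x ∷ xs) (job x) j x y
    pairRun-finish x {xs = xs} {j} e final x≢j r w = dur x , finish₁ final r , (begin-equality
      spent (x ∷ xs) (job x) j + spent (x ∷ xs) j (job x)
        ≈⟨ +-cong (spent-continue x xs (finishes-other x x≢j)) (spent-finish x xs (final-finishes final)) ⟩
      share x (job x) + spent xs (job x) j + share x j
        ≈⟨ +-cong (+-cong (reflexive (share-own x)) (spent-without e w j)) (reflexive (share-other x x≢j)) ⟩
      dur x + 0# + 0#
        ≈⟨ trans (+-identityʳ _) (+-identityʳ _) ⟩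
      dur x ∎)
      where
      open ≤-Reasoning
      final-finishes : ∀ {x} → Final x → finishes x (job x) ≡ true
      final-finishes (execute i)  = dec-true (i ≟ i) ≡.refl
      final-finishes (untested i) = dec-true (i ≟ i) ≡.refl

    pairRun : ∀ {q xs i j x y} → Execution Pick q xs → i ≢ j → Sole i x q → Sole j y q →
              PairSpent xs i j x y

    -- A step on the first job of the pair: a test prolongs the pair run and any other task ends it.
    -- Steps on the second job are reduced to this by `flip-spent`.
    pairRun-own : ∀ x {q xs i j y} → Execution Pick (release x q) xs → i ≢ j → job x ≡ i → R x y →
                  Without i q → Sole j y (release x q) → PairSpent (x ∷ xs) i j x y
    pairRun-own (test i) {j = j} e i≢j ≡.refl r w sole with pairRun e i≢j (here ≡.refl w) sole
    ... | d , run , eq = t i + d , test₁ r run , (begin-equality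
        _  ≈⟨ +-cong (+-congʳ (reflexive (share-own (test i))))
                  (+-congʳ (reflexive (share-other (test i) i≢j))) ⟩
        _  ≈⟨ solve 3 (λ t a b → t :+ a :+ (con 0 :+ b) := t :+ (a :+ b)) refl (t i) _ _ ⟩
        _  ≈⟨ +-congˡ eq ⟩
        _  ∎)
      where open ≤-Reasoning
    pairRun-own x@(execute i)  e i≢j ≡.refl r w sole = pairRun-finish x e (execute i) i≢j r w
    pairRun-own x@(untested i) e i≢j ≡.refl r w sole = pairRun-finish x e (untested i) i≢j r w

    pairRun [] i≢j ()
    pairRun {xs = z ∷ xs} (step z∈q pk e) i≢j si sj with sole-step si z∈q | sole-step sj z∈q
    ... | inj₁ (z≢i , si′) | inj₁ (z≢j , sj′) with pairRun e i≢j si′ sj′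
    ...   | d , run , eq = d , run , trans (+-cong (spent-skip z xs z≢i z≢j) (spent-skip z xs z≢j z≢i)) eq
    pairRun (step z∈q pk e) i≢j si sj | inj₂ (≡.refl , w) | inj₁ (z≢j , sj′) =
      pairRun-own _ e i≢j (Sole⇒job si) (pick pk (Sole⇒∈ sj)) w sj′
    pairRun {xs = zs@(_ ∷ _)} {i} {j} (step z∈q pk e) i≢j si sj | inj₁ (z≢i , si′) | inj₂ (≡.refl , w) =
      flip-spent {zs} {j} {i} (pairRun-own _ e (i≢j ∘ ≡.sym) (Sole⇒job sj) (pick pk (Sole⇒∈ si)) w si′)
    pairRun (step z∈q pk e) i≢j si sj | inj₂ (≡.refl , w) | inj₂ (≡.refl , w′) =
      contradiction (≡.trans (≡.sym (Sole⇒job si)) (Sole⇒job sj)) i≢j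

  -- The job that completes first has received all its remaining time, and a test of the other job
  -- only adds to `d`. Valid for every `R`, this supplies the lower bound for the optimum.
  remaining-first : ∀ {R : Task n → Task n → Set ℓ} {x y d} →
                    PairRun R x y d → remaining x ≤ d ⊎ remaining y ≤ d
  remaining-first (finish₁ (execute _) _)  = inj₁ ≤-refl
  remaining-first (finish₁ (untested _) _) = inj₁ ≤-refl
  remaining-first (finish₂ (execute _) _)  = inj₂ ≤-refl
  remaining-first (finish₂ (untested _) _) = inj₂ ≤-refl
  remaining-first (test₁ {i} _ run) with remaining-first run
  ... | inj₁ le = inj₁ (+-monoʳ-≤ (t i) le)
  ... | inj₂ le = inj₂ (≤-trans le (y≤x+y (proj₁ (t>0 i))))
  remaining-first (test₂ {j = j} _ run) with remaining-first run
  ... | inj₁ le = inj₁ (≤-trans le (y≤x+y (proj₁ (t>0 j))))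
  ... | inj₂ le = inj₂ (+-monoʳ-≤ (t j) le)

  -- Bounds what job j can contribute to a run of 2-RPCP, as the time until one
  -- of j and another job completes, when j is tested (true) or not (false).
  data Charge (j : Fin n) (d : Carrier) : Bool → Set ℓ₂ where
    late  : fromℕ 2 * d ≤ fromℕ 3 * (t j + p j)         → Charge j d true
    twice : fromℕ 2 * d ≤ fromℕ 2 * (t j + (t j + p j)) → Charge j d true
    plain : fromℕ 2 * d ≤ fromℕ 3 * u j                 → Charge j d false

  Charge-resp : ∀ {j d d′ b} → d′ ≈ d → Charge j d b → Charge j d′ b
  Charge-resp eq (late le)  = late  (≤-trans (≤-reflexive (*-congˡ eq)) le)
  Charge-resp eq (twice le) = twice (≤-trans (≤-reflexive (*-congˡ eq)) le)
  Charge-resp eq (plain le) = plain (≤-trans (≤-reflexive (*-congˡ eq)) le)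

  charge-own : ∀ b j → Charge j (remaining (entry b j)) b
  charge-own true  j = late  (*-monoʳ-≤ (0≤x+y (proj₁ (t>0 j)) (p≥0 j)) (fromℕ-mono-≤ {2} {3} (ℕₚ.n≤1+n 2)))
  charge-own false j = plain (*-monoʳ-≤ (proj₁ (u>0 j)) (fromℕ-mono-≤ {2} {3} (ℕₚ.n≤1+n 2)))

  open RPCP I (fromℕ 2) using (weight)

  Lighter : Task n → Task n → Set ℓ₂
  Lighter x y = weight x ≤ weight y

  -- If `i` completes first, `j` has contributed at most its test, and when that test was run after
  -- or before a task of `i` that was waiting, 2 t_j was at most the weight of that task. If `j`
  -- completes first, the weight of its final task equals its full time, since an execution weighs t
  -- + p; that weight is at most the weight of the waiting task of `i`, and only a test of `i` can
  -- come on top.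
  charge-pair : ∀ b b′ {i j d} → PairRun Lighter (entry b i) (entry b′ j) d → Charge i d b
  charge-pair false false (finish₁ _ _) = charge-own false _
  charge-pair false false {i} {j} (finish₂ _ uj≤ui) =
    plain (certify (*-monoˡ-≤ (fromℕ-nonNeg 2) uj≤ui ⊕ proj₁ (u>0 i))
      (solve 2 (λ ui uj → num 2 :* uj :+ (num 2 :* ui :+ ui) := num 3 :* ui :+ (num 2 :* uj :+ con 0))
        refl (u i) (u j)))
  charge-pair false true (finish₁ _ _) = charge-own false _
  charge-pair false true {i} {j} (test₂ 2tj≤ui (finish₁ _ _)) =
    plain (certify 2tj≤ui
      (solve 2 (λ ui tj → num 2 :* (tj :+ ui) :+ ui := num 3 :* ui :+ num 2 :* tj) refl (u i) (t j)))
  charge-pair false true {i} {j} (test₂ 2tj≤ui (finish₂ _ aj≤ui)) =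
    plain (certify (*-monoˡ-≤ (fromℕ-nonNeg 2) aj≤ui ⊕ proj₁ (u>0 i))
      (solve 2 (λ ui aj → num 2 :* aj :+ (num 2 :* ui :+ ui) := num 3 :* ui :+ (num 2 :* aj :+ con 0))
        refl (u i) (t j + p j)))
  charge-pair true false {i} {j} (finish₂ _ uj≤2ti) =
    twice (certify (*-monoˡ-≤ (fromℕ-nonNeg 2) uj≤2ti ⊕ *-nonNeg (fromℕ-nonNeg 2) (p≥0 i))
      (solve 3 (λ ti pi uj → num 2 :* uj :+ (num 2 :* (num 2 :* ti) :+ num 2 :* pi)
                          := num 2 :* (ti :+ (ti :+ pi)) :+ (num 2 :* uj :+ con 0)) refl (t i) (p i) (u j)))
  charge-pair true false (test₁ _ (finish₁ _ _)) = charge-own true _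
  charge-pair true false {i} {j} (test₁ _ (finish₂ _ uj≤ai)) =
    twice (*-monoˡ-≤ (fromℕ-nonNeg 2) (+-monoʳ-≤ (t i) uj≤ai))
  charge-pair true true (test₁ _ (finish₁ _ _)) = charge-own true _
  -- The test of `j` falls between the two tasks of `i` and adds up to half of t + p: the origin of
  -- the bound 3a/2 for tested jobs.
  charge-pair true true {i} {j} (test₁ _ (test₂ 2tj≤ai (finish₁ _ _))) =
    late (certify 2tj≤ai
      (solve 3 (λ ti pi tj → num 2 :* (ti :+ (tj :+ pi)) :+ (ti :+ pi)
                          := num 3 :* (ti :+ pi) :+ num 2 :* tj) refl (t i) (p i) (t j)))
  charge-pair true true {i} {j} (test₁ _ (test₂ _ (finish₂ _ aj≤ai))) =
    twice (*-monoˡ-≤ (fromℕ-nonNeg 2) (+-monoʳ-≤ (t i) aj≤ai))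
  charge-pair true true {i} {j} (test₂ 2tj≤2ti (finish₂ _ aj≤2ti)) =
    twice (certify (*-monoˡ-≤ (fromℕ-nonNeg 2) aj≤2ti ⊕ *-nonNeg (fromℕ-nonNeg 2) (p≥0 i))
      (solve 3 (λ ti pi aj → num 2 :* aj :+ (num 2 :* (num 2 :* ti) :+ num 2 :* pi)
                          := num 2 :* (ti :+ (ti :+ pi)) :+ (num 2 :* aj :+ con 0))
        refl (t i) (p i) (t j + p j)))
  charge-pair true true {i} {j} (test₂ 2tj≤2ti (test₁ _ (finish₁ _ _))) =
    twice (certify 2tj≤2ti
      (solve 3 (λ ti pi tj → num 2 :* (tj :+ (ti :+ pi)) :+ num 2 :* ti
                          := num 2 :* (ti :+ (ti :+ pi)) :+ num 2 :* tj) refl (t i) (p i) (t j)))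
  charge-pair true true {i} {j} (test₂ _ (test₁ _ (finish₂ _ aj≤ai))) =
    twice (certify (*-monoˡ-≤ (fromℕ-nonNeg 2) aj≤ai)
      (solve 4 (λ ti pi tj pj → num 2 :* (tj :+ (ti :+ pj)) :+ num 2 :* (ti :+ pi)
                             := num 2 :* (ti :+ (ti :+ pi)) :+ num 2 :* (tj :+ pj))
        refl (t i) (p i) (t j) (p j)))

-- Expectations and the final comparison

module Expectation {c ℓ₁ ℓ₂} (K : OrderedField c ℓ₁ ℓ₂) where
  open OrderedField K
  open OrderedFieldProperties K
  open Sum +-commutativeMonoid using (sum)
  open Scheduling K

  𝔼-cong : ∀ {n} (P : Vec Carrier n) {f g} → (∀ T → f T ≈ g T) → 𝔼 P f ≈ 𝔼 P g
  𝔼-cong []      f≈g = f≈g []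
  𝔼-cong (π ∷ P) f≈g = +-cong (*-congˡ (𝔼-cong P (λ T → f≈g (true ∷ T))))
                             (*-congˡ (𝔼-cong P (λ T → f≈g (false ∷ T))))

  𝔼-mono-≤ : ∀ {n} (P : Vec Carrier n) {f g} → (∀ j → 0# ≤ lookup P j × 0# ≤ 1# - lookup P j) →
             (∀ T → f T ≤ g T) → 𝔼 P f ≤ 𝔼 P g
  𝔼-mono-≤ []      prob f≤g = f≤g []
  𝔼-mono-≤ (π ∷ P) prob f≤g =
    *-monoˡ-≤ (proj₁ (prob zero)) (𝔼-mono-≤ P (prob ∘ suc) (λ T → f≤g (true ∷ T))) ⊕
    *-monoˡ-≤ (proj₂ (prob zero)) (𝔼-mono-≤ P (prob ∘ suc) (λ T → f≤g (false ∷ T)))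

  average : ∀ π x → π * x + (1# - π) * x ≈ x
  average π x = trans (sym (distribʳ x π (1# - π)))
    (trans (*-congʳ (trans (+-comm π (1# - π)) (x-y+y 1# π))) (*-identityˡ x))

  𝔼-const : ∀ {n} (P : Vec Carrier n) x → 𝔼 P (λ _ → x) ≈ x
  𝔼-const []      x = refl
  𝔼-const (π ∷ P) x = trans (+-cong (*-congˡ (𝔼-const P x)) (*-congˡ (𝔼-const P x))) (average π x)

  𝔼-+ : ∀ {n} (P : Vec Carrier n) f g → 𝔼 P (λ T → f T + g T) ≈ 𝔼 P f + 𝔼 P g
  𝔼-+ []      f g = refl
  𝔼-+ (π ∷ P) f g = trans (+-cong (*-congˡ (𝔼-+ P _ _)) (*-congˡ (𝔼-+ P _ _)))
    (solve 6 (λ π q a b c d → π :* (a :+ b) :+ q :* (c :+ d) := π :* a :+ q :* c :+ (π :* b :+ q :* d))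
      refl π (1# - π) _ _ _ _)

  𝔼-* : ∀ {n} (P : Vec Carrier n) k f → 𝔼 P (λ T → k * f T) ≈ k * 𝔼 P f
  𝔼-* []      k f = refl
  𝔼-* (π ∷ P) k f = trans (+-cong (*-congˡ (𝔼-* P k _)) (*-congˡ (𝔼-* P k _)))
    (solve 5 (λ π q k a b → π :* (k :* a) :+ q :* (k :* b) := k :* (π :* a :+ q :* b)) refl π (1# - π) k _ _)

  𝔼-sum : ∀ {n m} (P : Vec Carrier n) (f : Fin m → Subset n → Carrier) →
          𝔼 P (λ T → sum (λ i → f i T)) ≈ sum (λ i → 𝔼 P (f i))
  𝔼-sum {m = ℕ.zero}  P f = 𝔼-const P 0#
  𝔼-sum {m = ℕ.suc m} P f = trans (𝔼-+ P (f zero) _) (+-congˡ (𝔼-sum P (f ∘ suc)))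

  -- The choices for all other jobs average out, leaving the random choice for `j` alone.
  𝔼-lookup : ∀ {n} (P : Vec Carrier n) j (f : Bool → Carrier) →
             𝔼 P (λ T → f (lookup T j)) ≈ lookup P j * f true + (1# - lookup P j) * f false
  𝔼-lookup (π ∷ P) zero    f = +-cong (*-congˡ (𝔼-const P (f true))) (*-congˡ (𝔼-const P (f false)))
  𝔼-lookup (π ∷ P) (suc j) f =
    trans (+-cong (*-congˡ (𝔼-lookup P j f)) (*-congˡ (𝔼-lookup P j f))) (average π _)

  sum-mono-*-≤ : ∀ {m} k {f g : Fin m → Carrier} → (∀ i → f i ≤ k * g i) → sum f ≤ k * sum g
  sum-mono-*-≤ {ℕ.zero}  k f≤kg = ≤-reflexive (sym (zeroʳ k))
  sum-mono-*-≤ {ℕ.suc m} k f≤kg =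
    ≤-trans (f≤kg zero ⊕ sum-mono-*-≤ k (f≤kg ∘ suc)) (≤-reflexive (sym (distribˡ k _ _)))

module Analysis {c ℓ₁ ℓ₂} (K : OrderedField c ℓ₁ ℓ₂) where
  open OrderedField K
  open OrderedFieldProperties K
  open Sum +-commutativeMonoid using (sum)
  open Scheduling K
  open Ratio K
  open Expectation K

  module _ {s ρ} (s-sqrt : IsSqrt (fromℕ 6) s) (20ρ : fromℕ 20 * ρ ≈ fromℕ 3 * (fromℕ 7 + fromℕ 3 * s)) where

    module _ {n} (I : Instance n) where
      open Instance I
      open Accounting K I

      P : Vec Carrier n
      P = tabulate (λ j → testProbability (u j / t j))

      P-testing : ∀ j → Testing ρ (u j / t j) (lookup P j)
      P-testing j =
        ≡.subst (Testing ρ (u j / t j)) (≡.sym (lookup∘tabulate _ j)) (testing s-sqrt 20ρ (u j / t j))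

      P-probability : ∀ j → 0# ≤ lookup P j × 0# ≤ 1# - lookup P j
      P-probability j = testing-probability (P-testing j)

      -- Here `b` will be the decision of the optimum on `j`, which is unrelated to the random `T`.
      -- The two final bounds of `budget` serve its two values.
      expected-charge : ∀ {f} j → (∀ T → Charge j (f T) (lookup T j)) → ∀ b → 𝔼 P f ≤ ρ * remaining (entry b j)
      expected-charge {f} j charge b
        with budget s-sqrt 20ρ (t>0 j) (proj₁ (u>0 j)) (p≥0 j) (p≤u j) (P-testing j)
      ... | v , 3a≤v , 2[t+a]≤v , ≤a , ≤u = *-cancelˡ-≤ (fromℕ-nonNeg 2) (fromℕ-≉0 1) (begin
        fromℕ 2 * 𝔼 P f                                        ≈⟨ 𝔼-* P (fromℕ 2) f ⟨
        𝔼 P (λ T → fromℕ 2 * f T)                              ≤⟨ 𝔼-mono-≤ P P-probability bounded ⟩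
        𝔼 P (λ T → allowance (lookup T j))                     ≈⟨ 𝔼-lookup P j allowance ⟩
        lookup P j * v + (1# - lookup P j) * (fromℕ 3 * u j)   ≤⟨ chosen b ⟩
        fromℕ 2 * ρ * remaining (entry b j)                    ≈⟨ *-assoc (fromℕ 2) ρ _ ⟩
        fromℕ 2 * (ρ * remaining (entry b j))                  ∎)
        where
        open ≤-Reasoning
        allowance : Bool → Carrier
        allowance b = if b then v else fromℕ 3 * u j

        bound : ∀ {d b} → Charge j d b → fromℕ 2 * d ≤ allowance b
        bound (late le)  = ≤-trans le 3a≤v
        bound (twice le) = ≤-trans le 2[t+a]≤v
        bound (plain le) = le

        bounded : ∀ T → fromℕ 2 * f T ≤ allowance (lookup T j)
        bounded T = bound (charge T)

        chosen : ∀ b → _ ≤ fromℕ 2 * ρ * remaining (entry b j)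
        chosen true  = ≤a
        chosen false = ≤u

      module _ (runs : RPCPRuns I (fromℕ 2)) (S : Schedule I) where
        open RPCPRuns runs
        open Schedule S using (tested) renaming (order to optimal; execution to optimal-execution)

        -- The job to be charged is the one whose full time bounds the optimum's share of the pair.
        -- It is determined by the optimal schedule and not by `T`, so it stays fixed while the
        -- expectation is taken.
        expected-pair : ∀ i j → 𝔼 P (λ T → spent (order T) i j + spent (order T) j i) ≤
                                ρ * (spent optimal i j + spent optimal j i)
        expected-pair i j with i ≟ j
        -- On the diagonal both summands are the full time of the same job, and `charge-own`
        -- applies.
        ... | yes ≡.refl = begin
          𝔼 P (λ T → spent (order T) i i + spent (order T) i i)              ≈⟨ 𝔼-+ P _ _ ⟩
          𝔼 P (λ T → spent (order T) i i) + 𝔼 P (λ T → spent (order T) i i)  ≤⟨ half ⊕ half ⟩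
          ρ * spent optimal i i + ρ * spent optimal i i                      ≈⟨ distribˡ ρ _ _ ⟨
          ρ * (spent optimal i i + spent optimal i i)                        ∎
          where
          open ≤-Reasoning
          half : 𝔼 P (λ T → spent (order T) i i) ≤ ρ * spent optimal i i
          half = ≤-trans
            (expected-charge i
              (λ T → Charge-resp (spent-own (execution T) (initial-sole T i)) (charge-own (lookup T i) i))
              (lookup tested i))
            (≤-reflexive (*-congˡ (sym (spent-own optimal-execution (initial-sole tested i)))))
        ... | no i≢j
          with pairRun (λ _ _ → tt) optimal-execution i≢j (initial-sole tested i) (initial-sole tested j)
        ... | d , run , eq = ≤-trans (through (remaining-first run)) (≤-reflexive (*-congˡ (sym eq)))
          where
          charged : ∀ {i j} → i ≢ j → ∀ T → Charge i (spent (order T) i j + spent (order T) j i) (lookup T i)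
          charged {i} {j} i≢j T
            with pairRun (λ pk y∈q → All.lookup pk y∈q) (execution T) i≢j (initial-sole T i) (initial-sole T j)
          ... | d , run , eq = Charge-resp eq (charge-pair (lookup T i) (lookup T j) run)

          through : remaining (entry (lookup tested i) i) ≤ d ⊎ remaining (entry (lookup tested j) j) ≤ d →
                    _ ≤ ρ * d
          through (inj₁ le) = ≤-trans (expected-charge i (charged i≢j) (lookup tested i))
                                      (*-monoˡ-≤ (0≤ρ s-sqrt 20ρ) le)
          through (inj₂ le) = ≤-trans
            (expected-charge j (λ T → Charge-resp (+-comm _ _) (charged (i≢j ∘ ≡.sym) T)) (lookup tested j))
            (*-monoˡ-≤ (0≤ρ s-sqrt 20ρ) le)

        expected-cost : 𝔼 P (λ T → cost I (order T)) ≤ ρ * scheduleCost I S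
        expected-cost = *-cancelˡ-≤ (fromℕ-nonNeg 2) (fromℕ-≉0 1) (begin
          fromℕ 2 * 𝔼 P (λ T → cost I (order T))
            ≈⟨ twice-≈ _ ⟩
          𝔼 P (λ T → cost I (order T)) + 𝔼 P (λ T → cost I (order T))
            ≈⟨ 𝔼-+ P _ _ ⟨
          𝔼 P (λ T → cost I (order T) + cost I (order T))
            ≈⟨ 𝔼-cong P (λ T → cost-by-pairs T (execution T)) ⟩
          𝔼 P (λ T → sum (λ j → sum (λ i → spent (order T) i j + spent (order T) j i)))
            ≈⟨ 𝔼-sum P (λ j T → sum (λ i → spent (order T) i j + spent (order T) j i)) ⟩
          sum (λ j → 𝔼 P (λ T → sum (λ i → spent (order T) i j + spent (order T) j i)))
            ≤⟨ sum-mono-*-≤ ρ (λ j → ≤-trans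
                  (≤-reflexive (𝔼-sum P (λ i T → spent (order T) i j + spent (order T) j i)))
                  (sum-mono-*-≤ ρ (λ i → expected-pair i j))) ⟩
          ρ * sum (λ j → sum (λ i → spent optimal i j + spent optimal j i))
            ≈⟨ *-congˡ (cost-by-pairs tested optimal-execution) ⟨
          ρ * (scheduleCost I S + scheduleCost I S)
            ≈⟨ solve 2 (λ ρ x → ρ :* (x :+ x) := num 2 :* (ρ :* x)) refl ρ _ ⟩
          fromℕ 2 * (ρ * scheduleCost I S) ∎)
          where
          open ≤-Reasoning
          twice-≈ : ∀ x → fromℕ 2 * x ≈ x + x
          twice-≈ = solve 1 (λ x → num 2 :* x := x :+ x) refl

    competitive : RPCP-CompetitiveRatioAtMost (fromℕ 2) testProbability ρ
    competitive I runs opt isOPT =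
      ≤-trans (expected-cost I runs schedule) (*-monoˡ-≤ (0≤ρ s-sqrt 20ρ) (≤-reflexive attained))
      where open IsOPT isOPT

corollary13 : ∀ {c ℓ₁ ℓ₂} (K : OrderedField c ℓ₁ ℓ₂) →
    let open OrderedField K
        open Scheduling K
    in (√6 : Carrier) → IsSqrt (fromℕ 6) √6 →
       let ρ = fromℕ 3 * (fromℕ 7 + fromℕ 3 * √6) / fromℕ 20
       in RPCP-CompetitiveRatioAtMost (fromℕ 2) testProbability ρ
          × ρ ≤ fromℕ 2152271 / fromℕ 1000000
corollary13 K √6 √6-sqrt = Analysis.competitive K √6-sqrt 20ρ , Numerics.ρ-upper K √6-sqrt 20ρ
  where
  open OrderedField K
  open OrderedFieldProperties K
  20ρ : fromℕ 20 * (fromℕ 3 * (fromℕ 7 + fromℕ 3 * √6) / fromℕ 20) ≈ fromℕ 3 * (fromℕ 7 + fromℕ 3 * √6)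
  20ρ = trans (*-comm (fromℕ 20) _) (/-*-cancel _ (fromℕ-≉0 19))
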